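{- Let $r\ge 2$ and let $F$ be an $r$-graph with at least one edge. Then the limit $$\gamma^+(F)=\lim_{n\to\infty}\frac{\mathrm{co^+ex}(n,F)}{n}$$ exists. Moreover, for every $\varepsilon>0$ there exists an $F$-free $r$-graph $H=H(F,\varepsilon)$ such that every blow-up of $H$ is $F$-free, and for all sufficiently large $n$, $$\frac{\delta_{r-1}^+(H[n/v(H)])}{n}>\gamma^+(F)-\varepsilon .$$
   Context: An $r$-graph is a finite $r$-uniform hypergraph; $v(H)$ is the number of vertices of $H$. The minimum positive co-degree $\delta_{r-1}^+(H)$ of a non-empty $r$-graph $H$ is the maximum $k$ such that every $(r-1)$-set of vertices contained in some edge of $H$ is contained in at least $k$ distinct edges of $H$; by convention it is $0$ if $H$ has no edges. A hypergraph is $F$-free if it has no (not necessarily induced) subhypergraph isomorphic to $F$. $\mathrm{co^+ex}(n,F)$ is the maximum of $\delta_{r-1}^+(H)$ over all $n$-vertex $F$-free $r$-graphs $H$. A blow-up of $H$ is an $r$-graph obtained by replacing each vertex $v_i$ of $H$ by a class $V_i$ of vertices (classes pairwise disjoint), where $r$ vertices form an edge if and only if they lie in $r$ distinct classes corresponding to the $r$ vertices of an edge of $H$. $H[n/v(H)]$ denotes a balanced blow-up of $H$ on $n$ vertices, i.e. one in which every class has size $\lfloor n/v(H)\rfloor$ or $\lceil n/v(H)\rceil$; the choice need not be unique, and the statement holds for any such balanced blow-up. -}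

module Defs where

import Algebra.Properties.CommutativeSemigroup as CommutativeSemigroup
open import Algebra.Bundles using (CommutativeMonoid)
open import Data.Bool using (Bool; true; false; _∧_; T; T?)
open import Data.Bool.Properties using (T-∧; T-≡)
open import Data.Fin using (Fin; zero; suc)
import Data.Fin.Properties as Fin
open import Data.Fin.Subset using (Subset; inside; outside; _∈_; _⊆_; ∣_∣)
open import Data.Fin.Subset.Properties using (_∈?_; _⊆?_; anySubset?)
open import Data.List using (List; []; _∷_; [_]; _++_; map; filter; length; cartesianProductWith; allFin)
open import Data.List.Properties using (filter-≐; map-cong; filter-none)
open import Data.List.Extrema.Nat using (max; min; min≤v⁺; v≤min⁺; xs≤max; argmax-sel)
open import Data.List.Membership.Propositional using (lose; find) renaming (_∈_ to _∈ˡ_)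
open import Data.List.Membership.Propositional.Properties
  using (∈-map⁺; ∈-map⁻; ∈-++⁺ˡ; ∈-++⁺ʳ; ∈-filter⁺; ∈-filter⁻; ∈-cartesianProductWith⁺; ∈-allFin)
open import Data.List.Relation.Unary.All as All using (All; []; _∷_)
open import Data.List.Relation.Unary.Any as Any using (Any; here; there)
open import Data.Integer using (+_)
open import Data.List.Relation.Unary.AllPairs using ([]; _∷_)
open import Data.List.Relation.Unary.Unique.Propositional using (Unique)
import Data.List.Relation.Unary.Unique.Propositional.Properties as Unique
open import Data.Nat as ℕ using (ℕ; zero; suc; NonZero; pred; _≤_; _⊔_; _≟_)
import Data.Nat.DivMod as ℕ
import Data.Nat.Properties as ℕ
open import Data.Product using (Σ-syntax; ∃-syntax; _×_; _,_; proj₁; proj₂)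
open import Data.Rational as ℚ using (ℚ; 0ℚ; ½)
import Data.Rational.Properties as ℚ
open import Data.Sum using (_⊎_; inj₁; inj₂)
open import Data.Vec using ([]; _∷_; tabulate)
open import Data.Vec.Properties using (tabulate-cong; ∷-injectiveʳ)
open import Function using (_∘_; id; Injective; Equivalence; mk⇔; case_of_)
open import Relation.Binary.PropositionalEquality
  using (_≡_; _≗_; refl; sym; trans; cong; subst)
open import Relation.Nullary using (¬_; Dec; yes; no; does; ¬?; _×-dec_; _→-dec_; contradiction)
open import Relation.Nullary.Decidable as Dec using (⌊_⌋; toWitness; does-⇔)

private variable
  r m n v : ℕ

record RGraph (r n : ℕ) : Set where
  field
    edge    : Subset n → Bool
    uniform : ∀ e → T (edge e) → ∣ e ∣ ≡ r

  Edge : Subset n → Set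
  Edge e = T (edge e)

  Edge? : ∀ e → Dec (Edge e)
  Edge? e = T? (edge e)

open RGraph public

restrict : ∀ r → (Subset n → Bool) → RGraph r n
restrict r f = record
  { edge    = λ e → ⌊ ∣ e ∣ ≟ r ⌋ ∧ f e
  ; uniform = λ e p → toWitness (proj₁ (Equivalence.to (T-∧ {⌊ ∣ e ∣ ≟ r ⌋}) p))
  }

image : (Fin m → Fin n) → Subset m → Subset n
image f e = tabulate λ j → does (Fin.any? λ i → (i ∈? e) ×-dec (f i Fin.≟ j))

infix 4 _⊑_ _⊑?_

_⊑_ : RGraph r m → RGraph r n → Set
_⊑_ {m = m} {n = n} F H = Σ[ f ∈ (Fin m → Fin n) ]
  Injective _≡_ _≡_ f × (∀ e → Edge F e → Edge H (image f e))

Free : RGraph r m → RGraph r n → Set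
Free F H = ¬ (F ⊑ H)

subsets : ∀ n → List (Subset n)
subsets zero    = [ [] ]
subsets (suc n) = map (outside ∷_) (subsets n) ++ map (inside ∷_) (subsets n)

codegree : RGraph r n → Subset n → ℕ
codegree {n = n} H S = length (filter (λ e → Edge? H e ×-dec (S ⊆? e)) (subsets n))

Positive : RGraph r n → Subset n → Set
Positive {r} H S = ∣ S ∣ ≡ pred r × ∃[ e ] (Edge H e × S ⊆ e)

Positive? : (H : RGraph r n) → ∀ S → Dec (Positive H S)
Positive? {r} H S = (∣ S ∣ ≟ pred r) ×-dec anySubset? λ e → Edge? H e ×-dec (S ⊆? e)

positiveSets : RGraph r n → List (Subset n)
positiveSets {n = n} H = filter (Positive? H) (subsets n)

minimum : List ℕ → ℕ
minimum []       = 0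
minimum (x ∷ xs) = min x xs

-- See δ⁺-bound, δ⁺-greatest and δ⁺-edgeless for the characterisation as
-- the largest k such that every positive (r-1)-set has co-degree at least k.
δ⁺ : RGraph r n → ℕ
δ⁺ H = minimum (map (codegree H) (positiveSets H))

-- A blow-up of H with N vertices is given by the map sending each of its
-- vertices x to the vertex i of H whose class contains x.  Since edges of H
-- have r elements, an r-set whose image is an edge meets r distinct classes.
blowup : ∀ {N} → RGraph r v → (Fin N → Fin v) → RGraph r N
blowup {r} H c = restrict r (edge H ∘ image c)

vertexClass : ∀ {N} → (Fin N → Fin v) → Fin v → Subset N
vertexClass c i = tabulate λ x → does (c x Fin.≟ i)

⌊_/_⌋ ⌈_/_⌉ : (n d : ℕ) .{{_ : NonZero d}} → ℕ
⌊ n / d ⌋ = n ℕ./ d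
⌈ n / d ⌉ = (n ℕ.+ pred d) ℕ./ d

Balanced : ∀ {N} .{{_ : NonZero v}} → (Fin N → Fin v) → Set
Balanced {v} {N} c = ∀ i →
  ∣ vertexClass c i ∣ ≡ ⌊ N / v ⌋ ⊎ ∣ vertexClass c i ∣ ≡ ⌈ N / v ⌉

functions : ∀ m n → List (Fin m → Fin n)
functions zero    n = [ (λ ()) ]
functions (suc m) n = cartesianProductWith cons (allFin n) (functions m n)
  where
  cons : Fin n → (Fin m → Fin n) → Fin (suc m) → Fin n
  cons x f zero    = x
  cons x f (suc i) = f i

families : ∀ n → List (Subset n → Bool)
families zero    = (λ _ → false) ∷ (λ _ → true) ∷ []
families (suc n) = cartesianProductWith split (families n) (families n)
  where
  split : (Subset n → Bool) → (Subset n → Bool) → Subset (suc n) → Bool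
  split f g (outside ∷ s) = f s
  split f g (inside  ∷ s) = g s

rgraphs : ∀ r n → List (RGraph r n)
rgraphs r n = map (restrict r) (families n)

subsets-complete : (s : Subset n) → s ∈ˡ subsets n
subsets-complete []            = here refl
subsets-complete (outside ∷ s) = ∈-++⁺ˡ (∈-map⁺ _ (subsets-complete s))
subsets-complete (inside  ∷ s) = ∈-++⁺ʳ _ (∈-map⁺ _ (subsets-complete s))

-- Hence codegree counts distinct edges.
subsets-unique : ∀ n → Unique (subsets n)
subsets-unique zero    = [] ∷ []
subsets-unique (suc n) = Unique.++⁺
  (Unique.map⁺ ∷-injectiveʳ (subsets-unique n))
  (Unique.map⁺ ∷-injectiveʳ (subsets-unique n))
  λ (p , q) → case ∈-map⁻ (outside ∷_) p , ∈-map⁻ (inside ∷_) q of λ where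
    ((_ , _ , refl) , (_ , _ , ()))

functions-complete : (f : Fin m → Fin n) → ∃[ g ] (g ∈ˡ functions m n × f ≗ g)
functions-complete {zero}  f = _ , here refl , λ ()
functions-complete {suc m} f with functions-complete (f ∘ suc)
... | g , g∈ , f≗g = _ , ∈-cartesianProductWith⁺ _ (∈-allFin (f zero)) g∈
                   , λ { zero → refl ; (suc i) → f≗g i }

families-complete : (f : Subset n → Bool) → ∃[ g ] (g ∈ˡ families n × f ≗ g)
families-complete {zero} f with f [] in eq
... | false = _ , here refl , λ { [] → eq }
... | true  = _ , there (here refl) , λ { [] → eq }
families-complete {suc n} f
  with families-complete (f ∘ (outside ∷_)) | families-complete (f ∘ (inside ∷_))
... | g , g∈ , f≗g | h , h∈ , f≗h = _ , ∈-cartesianProductWith⁺ _ g∈ h∈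
                   , λ { (outside ∷ s) → f≗g s ; (inside ∷ s) → f≗h s }

rgraphs-complete : (H : RGraph r n) → ∃[ G ] (G ∈ˡ rgraphs r n × edge H ≗ edge G)
rgraphs-complete {r} H with families-complete (edge H)
... | f , f∈ , H≗f = restrict r f , ∈-map⁺ _ f∈ , eq
  where
  eq : ∀ e → edge H e ≡ edge (restrict r f) e
  eq e with ∣ e ∣ ≟ r
  ... | yes _ = H≗f e
  ... | no ¬q with edge H e in p
  ...   | false = refl
  ...   | true  = contradiction (uniform H e (Equivalence.from T-≡ p)) ¬q

image-cong : {f g : Fin m → Fin n} → f ≗ g → ∀ e → image f e ≡ image g e
image-cong {f = f} {g} f≗g e = tabulate-cong λ j → does-⇔
  (mk⇔ (λ (i , i∈ , p) → i , i∈ , trans (sym (f≗g i)) p)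
       (λ (i , i∈ , p) → i , i∈ , trans (f≗g i) p))
  (Fin.any? λ i → (i ∈? e) ×-dec (f i Fin.≟ j))
  (Fin.any? λ i → (i ∈? e) ×-dec (g i Fin.≟ j))

_⊑?_ : (F : RGraph r m) (H : RGraph r n) → Dec (F ⊑ H)
_⊑?_ {m = m} {n = n} F H = Dec.map′ to from (Any.any? embeds? (functions m n))
  where
  Embeds : (Fin m → Fin n) → Set
  Embeds f = Injective _≡_ _≡_ f × (∀ e → Edge F e → Edge H (image f e))

  embeds? : ∀ f → Dec (Embeds f)
  embeds? f =
    Dec.map′ (λ p {x} {y} → p x y) (λ p x y → p)
      (Fin.all? λ x → Fin.all? λ y → (f x Fin.≟ f y) →-dec (x Fin.≟ y))
    ×-dec
    Dec.map′ (λ p e → All.lookup p (subsets-complete e)) (λ p → All.tabulate λ {e} _ → p e)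
      (All.all? (λ e → Edge? F e →-dec Edge? H (image f e)) (subsets m))

  to : Any Embeds (functions m n) → F ⊑ H
  to p with find p
  ... | f , _ , q = f , q

  from : F ⊑ H → Any Embeds (functions m n)
  from (f , inj , hom) with functions-complete f
  ... | g , g∈ , f≗g = lose g∈
    ( (λ {x} {y} p → inj (trans (f≗g x) (trans p (sym (f≗g y)))))
    , (λ e p → subst (Edge H) (image-cong f≗g e) (hom e p)))

Free? : (F : RGraph r m) (H : RGraph r n) → Dec (Free F H)
Free? F H = ¬? (F ⊑? H)

-- See co⁺ex-attained and co⁺ex-bound for the defining property.
co⁺ex : ℕ → RGraph r m → ℕ
co⁺ex {r} n F = max 0 (map δ⁺ (filter (Free? F) (rgraphs r n)))

minimum-≤ : ∀ {x xs} → x ∈ˡ xs → minimum xs ≤ x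
minimum-≤ {xs = y ∷ ys} (here refl) = min≤v⁺ y ys (inj₁ ℕ.≤-refl)
minimum-≤ {xs = y ∷ ys} (there p)   = min≤v⁺ y ys (inj₂ (Any.map (ℕ.≤-reflexive ∘ sym) p))

minimum-greatest : ∀ {k x xs} → x ∈ˡ xs → (∀ {y} → y ∈ˡ xs → k ≤ y) → k ≤ minimum xs
minimum-greatest {xs = y ∷ ys} _ h = v≤min⁺ (h (here refl)) (All.tabulate (h ∘ there))

subset-pred : (e : Subset n) → ∃[ S ] (∣ S ∣ ≡ pred ∣ e ∣ × S ⊆ e)
subset-pred []            = [] , refl , id
subset-pred (inside  ∷ e) = outside ∷ e , refl , λ { (Data.Vec.there p) → Data.Vec.there p }
subset-pred (outside ∷ e) with subset-pred e
... | S , p , q = outside ∷ S , p , λ { (Data.Vec.there x) → Data.Vec.there (q x) }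

δ⁺-bound : (H : RGraph r n) → ∀ S → Positive H S → δ⁺ H ≤ codegree H S
δ⁺-bound H S p =
  minimum-≤ (∈-map⁺ (codegree H) (∈-filter⁺ (Positive? H) (subsets-complete S) p))

δ⁺-greatest : (H : RGraph r n) → ∃[ e ] Edge H e →
              ∀ k → (∀ S → Positive H S → k ≤ codegree H S) → k ≤ δ⁺ H
δ⁺-greatest {n = n} H (e , p) k h with subset-pred e
... | S , ∣S∣ , S⊆e = minimum-greatest
  (∈-map⁺ (codegree H) (∈-filter⁺ (Positive? H) (subsets-complete S)
    (trans ∣S∣ (cong pred (uniform H e p)) , e , p , S⊆e)))
  λ y∈ → case ∈-map⁻ (codegree H) y∈ of λ where
    (T , T∈ , refl) → h T (proj₂ (∈-filter⁻ (Positive? H) {xs = subsets n} T∈))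

δ⁺-edgeless : (H : RGraph r n) → ¬ (∃[ e ] Edge H e) → δ⁺ H ≡ 0
δ⁺-edgeless {n = n} H ¬e = cong (minimum ∘ map (codegree H))
  (filter-none (Positive? H) {xs = subsets n}
    (All.tabulate λ _ (_ , e , p , _) → ¬e (e , p)))

δ⁺-cong : (G H : RGraph r n) → edge G ≗ edge H → δ⁺ G ≡ δ⁺ H
δ⁺-cong {n = n} G H G≗H = cong minimum (trans
  (map-cong (λ S → cong length (filter-≐
    (λ e → Edge? G e ×-dec (S ⊆? e)) (λ e → Edge? H e ×-dec (S ⊆? e))
    ( (λ {e} (p , q) → to e p , λ {x} → q {x})
    , (λ {e} (p , q) → from e p , λ {x} → q {x})) (subsets n)))
    (positiveSets G))
  (cong (map (codegree H)) (filter-≐ (Positive? G) (Positive? H)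
    ( (λ (s , e , p , q) → s , e , to e p , λ {x} → q {x})
    , (λ (s , e , p , q) → s , e , from e p , λ {x} → q {x})) (subsets n))))
  where
  to : ∀ e → Edge G e → Edge H e
  to e = subst T (G≗H e)
  from : ∀ e → Edge H e → Edge G e
  from e = subst T (sym (G≗H e))

edgeless : RGraph r n
edgeless .edge    _ = false
edgeless .uniform _ ()

co⁺ex-attained : ∀ n (F : RGraph r m) → ∃[ e ] Edge F e →
                 Σ[ H ∈ RGraph r n ] (Free F H × δ⁺ H ≡ co⁺ex n F)
co⁺ex-attained {r} n F (e , p)
  with argmax-sel id 0 (map δ⁺ (filter (Free? F) (rgraphs r n)))
... | inj₁ eq = edgeless , (λ (_ , _ , hom) → hom e p)
              , trans (δ⁺-edgeless (edgeless {r} {n}) λ ()) (sym eq)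
... | inj₂ k∈ with ∈-map⁻ δ⁺ k∈
...   | H , H∈ , eq = H , proj₂ (∈-filter⁻ (Free? F) {xs = rgraphs r n} H∈) , sym eq

co⁺ex-bound : ∀ n (F : RGraph r m) (H : RGraph r n) → Free F H → δ⁺ H ≤ co⁺ex n F
co⁺ex-bound {r} n F H free with rgraphs-complete H
... | G , G∈ , H≗G = subst (_≤ co⁺ex n F) (sym (δ⁺-cong H G H≗G))
  (All.lookup (xs≤max 0 (map δ⁺ (filter (Free? F) (rgraphs r n))))
    (∈-map⁺ δ⁺ (∈-filter⁺ (Free? F) G∈
      λ (f , inj , hom) → free (f , inj , λ e p → subst T (sym (H≗G _)) (hom e p)))))

record ℝ : Set where
  field
    seq    : ℕ → ℚ
    cauchy : ∀ ε → 0ℚ ℚ.< ε →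
             ∃[ N ] (∀ i j → N ≤ i → N ≤ j → ℚ.∣ seq i ℚ.- seq j ∣ ℚ.< ε)

open ℝ public

fromℚ : ℚ → ℝ
fromℚ q .seq    _ = q
fromℚ q .cauchy ε 0<ε = 0 , λ _ _ _ _ →
  subst (ℚ._< ε) (cong ℚ.∣_∣ (sym (ℚ.+-inverseʳ q))) 0<ε

0ℝ : ℝ
0ℝ = fromℚ 0ℚ

infixl 6 _+_ _-_
infix  8 -_

private
  open CommutativeSemigroup (CommutativeMonoid.commutativeSemigroup ℚ.+-0-commutativeMonoid)
    using (interchange)

  +-−-interchange : ∀ a b c d → (a ℚ.+ b) ℚ.- (c ℚ.+ d) ≡ (a ℚ.- c) ℚ.+ (b ℚ.- d)
  +-−-interchange a b c d = trans
    (cong ((a ℚ.+ b) ℚ.+_) (ℚ.neg-distrib-+ c d))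
    (interchange a b (ℚ.- c) (ℚ.- d))

  halves : ∀ ε → ½ ℚ.* ε ℚ.+ ½ ℚ.* ε ≡ ε
  halves ε = trans (sym (ℚ.*-distribʳ-+ ε ½ ½)) (ℚ.*-identityˡ ε)

  half-pos : ∀ {ε} → 0ℚ ℚ.< ε → 0ℚ ℚ.< ½ ℚ.* ε
  half-pos {ε} 0<ε = subst (ℚ._< ½ ℚ.* ε) (ℚ.*-zeroʳ ½) (ℚ.*-monoʳ-<-pos ½ 0<ε)

_+_ : ℝ → ℝ → ℝ
(x + y) .seq i = seq x i ℚ.+ seq y i
(x + y) .cauchy ε 0<ε with cauchy x _ (half-pos 0<ε) | cauchy y _ (half-pos 0<ε)
... | M , p | N , q = M ⊔ N , λ i j M⊔N≤i M⊔N≤j → begin-strict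
  ℚ.∣ (seq x i ℚ.+ seq y i) ℚ.- (seq x j ℚ.+ seq y j) ∣
    ≡⟨ cong ℚ.∣_∣ (+-−-interchange (seq x i) (seq y i) (seq x j) (seq y j)) ⟩
  ℚ.∣ (seq x i ℚ.- seq x j) ℚ.+ (seq y i ℚ.- seq y j) ∣
    ≤⟨ ℚ.∣p+q∣≤∣p∣+∣q∣ (seq x i ℚ.- seq x j) (seq y i ℚ.- seq y j) ⟩
  ℚ.∣ seq x i ℚ.- seq x j ∣ ℚ.+ ℚ.∣ seq y i ℚ.- seq y j ∣
    <⟨ ℚ.+-mono-< (p i j (ℕ.m⊔n≤o⇒m≤o M N M⊔N≤i) (ℕ.m⊔n≤o⇒m≤o M N M⊔N≤j))
                  (q i j (ℕ.m⊔n≤o⇒n≤o M N M⊔N≤i) (ℕ.m⊔n≤o⇒n≤o M N M⊔N≤j)) ⟩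
  ½ ℚ.* ε ℚ.+ ½ ℚ.* ε
    ≡⟨ halves ε ⟩
  ε ∎
  where open ℚ.≤-Reasoning

-_ : ℝ → ℝ
(- x) .seq i = ℚ.- seq x i
(- x) .cauchy ε 0<ε with cauchy x ε 0<ε
... | N , p = N , λ i j N≤i N≤j → subst (ℚ._< ε)
  (trans (sym (ℚ.∣-p∣≡∣p∣ (seq x i ℚ.- seq x j)))
         (cong ℚ.∣_∣ (ℚ.neg-distrib-+ (seq x i) (ℚ.- seq x j))))
  (p i j N≤i N≤j)

_-_ : ℝ → ℝ → ℝ
x - y = x + (- y)

infix 4 _<_ _⟶_
infix 7 _÷_

-- The gap δ is needed: strict inequality termwise does not separate the limits.
_<_ : ℝ → ℝ → Set
x < y = ∃[ δ ] (0ℚ ℚ.< δ × ∃[ N ] (∀ i → N ≤ i → seq x i ℚ.+ δ ℚ.≤ seq y i))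

_÷_ : ℕ → (n : ℕ) .{{_ : NonZero n}} → ℝ
k ÷ n = fromℚ (+ k ℚ./ n)

_⟶_ : ((n : ℕ) .{{_ : NonZero n}} → ℝ) → ℝ → Set
a ⟶ x = ∀ ε → 0ℝ < ε →
  ∃[ N ] (∀ n .{{_ : NonZero n}} → N ≤ n → x - ε < a n × a n < x + ε)

{-# OPTIONS --safe #-}
module Submission where

-- Call H hom-free if no map V(F) → V(H), injective or not, sends every edge of
-- F to an edge; then all blow-ups of H are F-free.  Let H be F-free on n
-- vertices and sample M of its vertices uniformly with repetition, where M
-- depends on the precision only.  By Cauchy–Schwarz, a positive density of
-- non-injective homomorphisms of a fixed type persists when the vertices of F
-- are split apart, and for n large yields an injective one; so the sample is
-- hom-free with high probability.  By a Chernoff bound its positive co-degrees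
-- are proportional to those of H, and it has an edge with probability bounded
-- below.  Hence co⁺ex n F / n is within ε of the largest δ⁺ / M of a hom-free
-- graph on M vertices for all n beyond an explicit bound.  This gives a
-- constructive Cauchy modulus, and the optimal hom-free graph is the required H.

-- Minimum positive co-degree is fragile: deleting one edge can lower it at many sets, so stray
-- images of `F` cannot be cleaned out of a sample afterwards. The sample must contain no
-- homomorphic image of `F` and no weak positive set at all. Both are union bounds over tuples of
-- sample positions, so each single bad event must be rarer than a fixed power of `1 / M`. On the
-- other hand, an edgeless sample meets every local condition and still has `δ⁺` zero. The event
-- that a fixed set of positions becomes an edge is only known to have probability at least
-- `1 / Q ^ suc r`, so the bad events together must stay below that and not merely below one; this
-- is the origin of `A = 3 * Q ^ suc r`. Drawing with repetition keeps the coordinates independent,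
-- and repeated vertices are harmless because the sampled hypergraph is the blow-up of `H` along the
-- sampling map. Probabilities are counts of tuples with all denominators multiplied out.

module Sums where

  open import Data.Bool using (if_then_else_)
  open import Data.Fin using (Fin; zero; suc; _↑ˡ_; _↑ʳ_)
  open import Data.Fin.Subset using (Subset; inside; outside)
  open import Data.Nat
  open import Data.Nat.Properties
  open import Data.Nat.Tactic.RingSolver using (solve-∀)
  open import Data.Product using (∃-syntax; _,_)
  open import Data.Sum using (inj₁; inj₂)
  open import Data.Vec using (Vec; []; _∷_; _[_]≔_)
  open import Function using (_∘_)
  open import Relation.Binary.PropositionalEquality
  open import Relation.Nullary using (¬_; Dec; does; yes; no; contradiction)

  open import Algebra.Properties.Semiring.Sum +-*-semiring public
    using (sum; sum-syntax; ∑-comm; ∑-distrib-+; sum-cong-≗; *-distribˡ-sum; *-distribʳ-sum)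

  private variable
    k m n : ℕ
    A B : Set

  -- Indicators and sums over finite sets

  𝟙 : Dec A → ℕ
  𝟙 d = if does d then 1 else 0

  𝟙-yes : (d : Dec A) → A → 𝟙 d ≡ 1
  𝟙-yes (yes _) _ = refl
  𝟙-yes (no ¬a) a = contradiction a ¬a

  𝟙-no : (d : Dec A) → ¬ A → 𝟙 d ≡ 0
  𝟙-no (yes a) ¬a = contradiction a ¬a
  𝟙-no (no _) _ = refl

  𝟙≤1 : (d : Dec A) → 𝟙 d ≤ 1
  𝟙≤1 (yes _) = ≤-refl
  𝟙≤1 (no _) = z≤n

  𝟙≡0⇒¬ : (d : Dec A) → 𝟙 d ≡ 0 → ¬ A
  𝟙≡0⇒¬ (no ¬a) _ = ¬a

  0<𝟙⇒ : (d : Dec A) → 0 < 𝟙 d → A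
  0<𝟙⇒ (yes a) _ = a

  𝟙-mono : (d : Dec A) (e : Dec B) → (A → B) → 𝟙 d ≤ 𝟙 e
  𝟙-mono (no _)  e f = z≤n
  𝟙-mono (yes a) e f = ≤-reflexive (sym (𝟙-yes e (f a)))

  𝟙-cong : (d : Dec A) (e : Dec B) → (A → B) → (B → A) → 𝟙 d ≡ 𝟙 e
  𝟙-cong d e f g = ≤-antisym (𝟙-mono d e f) (𝟙-mono e d g)

  𝟙-≤ : (d : Dec A) → (A → 1 ≤ n) → 𝟙 d ≤ n
  𝟙-≤ (no _)  h = z≤n
  𝟙-≤ (yes a) h = h a

  *-𝟙-≤ : ∀ c (d : Dec A) → (A → c ≤ n) → c * 𝟙 d ≤ n
  *-𝟙-≤ {n = n} c (no _)  h = subst (_≤ n) (sym (*-zeroʳ c)) z≤n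
  *-𝟙-≤ {n = n} c (yes a) h = subst (_≤ n) (sym (*-identityʳ c)) (h a)

  𝟙-*-≤ : (d : Dec A) (e : Dec B) → (A → B → 1 ≤ n) → 𝟙 d * 𝟙 e ≤ n
  𝟙-*-≤ (no _)  _       h = z≤n
  𝟙-*-≤ (yes _) (no _)  h = z≤n
  𝟙-*-≤ (yes a) (yes b) h = h a b

  sum-mono : {f g : Fin n → ℕ} → (∀ i → f i ≤ g i) → sum f ≤ sum g
  sum-mono {zero}  _ = z≤n
  sum-mono {suc n} h = +-mono-≤ (h zero) (sum-mono (h ∘ suc))

  sum-const : ∀ n c → sum {n} (λ _ → c) ≡ n * c
  sum-const zero    c = refl
  sum-const (suc n) c = cong (c +_) (sum-const n c)

  term≤sum : (f : Fin n → ℕ) → ∀ i → f i ≤ sum f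
  term≤sum f zero    = m≤m+n (f zero) _
  term≤sum f (suc i) = ≤-trans (term≤sum (f ∘ suc) i) (m≤n+m _ (f zero))

  sum-<⇒∃< : (f g : Fin n → ℕ) → sum f < sum g → ∃[ i ] f i < g i
  sum-<⇒∃< {suc n} f g h with <-≤-connex (f zero) (g zero)
  ... | inj₁ lt = zero , lt
  ... | inj₂ ge with sum-<⇒∃< (f ∘ suc) (g ∘ suc)
                       (≰⇒> λ le → <⇒≱ h (+-mono-≤ ge le))
  ...   | i , lt = suc i , lt

  sum-↑ : ∀ m n (f : Fin (m + n) → ℕ) →
          sum f ≡ sum (λ i → f (i ↑ˡ n)) + sum (λ j → f (m ↑ʳ j))
  sum-↑ zero    n f = refl
  sum-↑ (suc m) n f = trans (cong (f zero +_) (sum-↑ m n (f ∘ suc)))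
                            (sym (+-assoc (f zero) _ _))

  -- Simultaneous induction replaces the square of a difference: passing to successors adds
  -- `2 * suc (m + n)` on both sides.
  2mn≤m²+n² : ∀ m n → 2 * (m * n) ≤ m * m + n * n
  2mn≤m²+n² zero    n       = z≤n
  2mn≤m²+n² (suc m) zero    = subst (λ x → 2 * x ≤ suc m * suc m + 0) (sym (*-zeroʳ m)) z≤n
  2mn≤m²+n² (suc m) (suc n) = subst₂ _≤_ (lhs m n) (rhs m n)
    (+-monoˡ-≤ (2 * suc (m + n)) (2mn≤m²+n² m n))
    where
    lhs : ∀ m n → 2 * (m * n) + 2 * suc (m + n) ≡ 2 * (suc m * suc n)
    lhs = solve-∀
    rhs : ∀ m n → m * m + n * n + 2 * suc (m + n) ≡ suc m * suc m + suc n * suc n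
    rhs = solve-∀

  -- Induction on `n`; each cross term `2 * a * f (suc i)` is at most
  -- `a * a + f (suc i) * f (suc i)`.
  cauchy-schwarz : (f : Fin n → ℕ) → sum f * sum f ≤ n * ∑[ i < n ] (f i * f i)
  cauchy-schwarz {zero}  f = z≤n
  cauchy-schwarz {suc n} f = begin
    (a + s) * (a + s)
      ≡⟨ expand a s ⟩
    a * a + 2 * (a * s) + s * s
      ≤⟨ +-mono-≤ (+-monoʳ-≤ (a * a) cross) (cauchy-schwarz (f ∘ suc)) ⟩
    a * a + (n * (a * a) + q) + n * q
      ≡⟨ collect n (a * a) q ⟩
    suc n * (a * a + q) ∎
    where
    open ≤-Reasoning
    a = f zero
    s = sum (f ∘ suc)
    q = ∑[ i < n ] (f (suc i) * f (suc i))
    expand : ∀ a s → (a + s) * (a + s) ≡ a * a + 2 * (a * s) + s * s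
    expand = solve-∀
    collect : ∀ n x q → x + (n * x + q) + n * q ≡ suc n * (x + q)
    collect = solve-∀
    cross : 2 * (a * s) ≤ n * (a * a) + q
    cross = begin
      2 * (a * s)                        ≡⟨ *-assoc 2 a s ⟨
      2 * a * s                          ≡⟨ *-distribˡ-sum (2 * a) (f ∘ suc) ⟩
      ∑[ i < n ] (2 * a * f (suc i))     ≤⟨ sum-mono (λ i → ≤-trans (≤-reflexive (*-assoc 2 a _)) (2mn≤m²+n² a (f (suc i)))) ⟩
      ∑[ i < n ] (a * a + f (suc i) * f (suc i)) ≡⟨ ∑-distrib-+ {n} (λ _ → a * a) _ ⟩
      sum {n} (λ _ → a * a) + q          ≡⟨ cong (_+ q) (sum-const n (a * a)) ⟩
      n * (a * a) + q                    ∎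

  -- Sums over all tuples of sampled vertices

  ∑ᵛ : ∀ k → (Vec (Fin n) k → ℕ) → ℕ
  ∑ᵛ zero    f = f []
  ∑ᵛ (suc k) f = sum λ x → ∑ᵛ k λ s → f (x ∷ s)

  ∑ᵛ-cong : ∀ k {f g : Vec (Fin n) k → ℕ} → (∀ s → f s ≡ g s) → ∑ᵛ k f ≡ ∑ᵛ k g
  ∑ᵛ-cong zero    h = h []
  ∑ᵛ-cong (suc k) h = sum-cong-≗ λ x → ∑ᵛ-cong k λ s → h (x ∷ s)

  ∑ᵛ-mono : ∀ k {f g : Vec (Fin n) k → ℕ} → (∀ s → f s ≤ g s) → ∑ᵛ k f ≤ ∑ᵛ k g
  ∑ᵛ-mono zero    h = h []
  ∑ᵛ-mono (suc k) h = sum-mono λ x → ∑ᵛ-mono k λ s → h (x ∷ s)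

  ∑ᵛ-const : ∀ k c → ∑ᵛ {n} k (λ _ → c) ≡ n ^ k * c
  ∑ᵛ-const     zero    c = sym (+-identityʳ c)
  ∑ᵛ-const {n} (suc k) c = trans (sum-cong-≗ {n} λ _ → ∑ᵛ-const k c)
    (trans (sum-const n _) (sym (*-assoc n (n ^ k) c)))

  ∑ᵛ-distrib-+ : ∀ k (f g : Vec (Fin n) k → ℕ) →
                 ∑ᵛ k (λ s → f s + g s) ≡ ∑ᵛ k f + ∑ᵛ k g
  ∑ᵛ-distrib-+ zero    f g = refl
  ∑ᵛ-distrib-+ (suc k) f g = trans
    (sum-cong-≗ λ x → ∑ᵛ-distrib-+ k (λ s → f (x ∷ s)) (λ s → g (x ∷ s)))
    (∑-distrib-+ (λ x → ∑ᵛ k λ s → f (x ∷ s)) _)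

  *-distribˡ-∑ᵛ : ∀ k c (f : Vec (Fin n) k → ℕ) → c * ∑ᵛ k f ≡ ∑ᵛ k (λ s → c * f s)
  *-distribˡ-∑ᵛ zero    c f = refl
  *-distribˡ-∑ᵛ (suc k) c f = trans (*-distribˡ-sum c (λ x → ∑ᵛ k λ s → f (x ∷ s)))
    (sum-cong-≗ λ x → *-distribˡ-∑ᵛ k c (λ s → f (x ∷ s)))

  sum-∑ᵛ-comm : ∀ k (f : Fin m → Vec (Fin n) k → ℕ) →
                sum (λ i → ∑ᵛ k (f i)) ≡ ∑ᵛ k (λ s → sum λ i → f i s)
  sum-∑ᵛ-comm zero    f = refl
  sum-∑ᵛ-comm (suc k) f = trans (∑-comm λ i x → ∑ᵛ k λ s → f i (x ∷ s))
    (sum-cong-≗ λ x → sum-∑ᵛ-comm k λ i s → f i (x ∷ s))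

  ∑ᵛ-comm : ∀ j k (f : Vec (Fin m) j → Vec (Fin n) k → ℕ) →
            ∑ᵛ j (λ t → ∑ᵛ k (f t)) ≡ ∑ᵛ k (λ s → ∑ᵛ j λ t → f t s)
  ∑ᵛ-comm zero    k f = refl
  ∑ᵛ-comm (suc j) k f = trans
    (sum-cong-≗ λ x → ∑ᵛ-comm j k λ t → f (x ∷ t))
    (sum-∑ᵛ-comm k λ x s → ∑ᵛ j λ t → f (x ∷ t) s)

  term≤∑ᵛ : ∀ k (f : Vec (Fin n) k → ℕ) → ∀ s → f s ≤ ∑ᵛ k f
  term≤∑ᵛ zero    f []      = ≤-refl
  term≤∑ᵛ (suc k) f (x ∷ s) = ≤-trans (term≤∑ᵛ k (λ s → f (x ∷ s)) s)
                                      (term≤sum (λ x → ∑ᵛ k λ s → f (x ∷ s)) x)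

  ∑ᵛ-<⇒∃< : ∀ k (f g : Vec (Fin n) k → ℕ) → ∑ᵛ k f < ∑ᵛ k g → ∃[ s ] f s < g s
  ∑ᵛ-<⇒∃< zero    f g h = [] , h
  ∑ᵛ-<⇒∃< (suc k) f g h with sum-<⇒∃< _ _ h
  ... | x , h′ with ∑ᵛ-<⇒∃< k _ _ h′
  ...   | s , lt = x ∷ s , lt

  cauchy-schwarzᵛ : ∀ k (f : Vec (Fin n) k → ℕ) →
                    ∑ᵛ k f * ∑ᵛ k f ≤ n ^ k * ∑ᵛ k (λ s → f s * f s)
  cauchy-schwarzᵛ     zero    f = ≤-reflexive (sym (+-identityʳ _))
  cauchy-schwarzᵛ {n} (suc k) f = begin
    sum g * sum g                  ≤⟨ cauchy-schwarz g ⟩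
    n * ∑[ x < n ] (g x * g x)     ≤⟨ *-monoʳ-≤ n (sum-mono λ x → cauchy-schwarzᵛ k λ s → f (x ∷ s)) ⟩
    n * ∑[ x < n ] (n ^ k * h x)   ≡⟨ cong (n *_) (*-distribˡ-sum (n ^ k) h) ⟨
    n * (n ^ k * sum h)            ≡⟨ *-assoc n (n ^ k) _ ⟨
    n ^ suc k * sum h              ∎
    where
    open ≤-Reasoning
    g = λ x → ∑ᵛ k λ s → f (x ∷ s)
    h = λ x → ∑ᵛ k λ s → f (x ∷ s) * f (x ∷ s)

  -- The form in which union bounds are used: `n ^ k` events, each with a share of at most one in
  -- `a * n ^ k`, together have a share of at most one in `a`.
  ∑ᵛ-≤-average : ∀ k a b (f : Vec (Fin n) k → ℕ) → .{{NonZero (n ^ k)}} →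
                 (∀ s → a * n ^ k * f s ≤ b) → a * ∑ᵛ k f ≤ b
  ∑ᵛ-≤-average {n} k a b f h = *-cancelˡ-≤ (n ^ k) (begin
    n ^ k * (a * ∑ᵛ k f)           ≡⟨ swap (n ^ k) a _ ⟩
    a * n ^ k * ∑ᵛ k f             ≡⟨ *-distribˡ-∑ᵛ k (a * n ^ k) f ⟩
    ∑ᵛ k (λ s → a * n ^ k * f s)   ≤⟨ ∑ᵛ-mono k h ⟩
    ∑ᵛ k (λ _ → b)                 ≡⟨ ∑ᵛ-const k b ⟩
    n ^ k * b                      ∎)
    where
    open ≤-Reasoning
    swap : ∀ x y z → x * (y * z) ≡ y * x * z
    swap = solve-∀

  -- Each tuple arises from exactly `n` pairs of `s` and `z`: its entry at `i` determines `z`, and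
  -- the overwritten entry is arbitrary.
  ∑ᵛ-resample : ∀ k (f : Vec (Fin n) k → ℕ) i →
                n * ∑ᵛ k f ≡ ∑ᵛ k (λ s → ∑[ z < n ] f (s [ i ]≔ z))
  ∑ᵛ-resample {n} (suc k) f zero = begin
    n * sum (λ x → ∑ᵛ k λ s → f (x ∷ s))              ≡⟨ sum-const n _ ⟨
    ∑[ y < n ] sum (λ x → ∑ᵛ k λ s → f (x ∷ s))       ≡⟨ (sum-cong-≗ {n} λ _ → sum-∑ᵛ-comm k λ x s → f (x ∷ s)) ⟩
    ∑[ y < n ] ∑ᵛ k (λ s → ∑[ z < n ] f (z ∷ s))      ∎
    where open ≡-Reasoning
  ∑ᵛ-resample {n} (suc k) f (suc i) = trans
    (*-distribˡ-sum n (λ x → ∑ᵛ k λ s → f (x ∷ s)))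
    (sum-cong-≗ λ x → ∑ᵛ-resample k (λ s → f (x ∷ s)) i)

  merge : Subset k → Vec A k → Vec A k → Vec A k
  merge []            []      []      = []
  merge (inside  ∷ S) (x ∷ s) (y ∷ t) = x ∷ merge S s t
  merge (outside ∷ S) (x ∷ s) (y ∷ t) = y ∷ merge S s t

  -- Each tuple arises from `n ^ k` pairs, since the entries of `s` outside `S` and those of `t`
  -- inside `S` are lost. It makes two independent samples out of one.
  ∑ᵛ-merge : ∀ k (f : Vec (Fin n) k → ℕ) S →
             n ^ k * ∑ᵛ k f ≡ ∑ᵛ k (λ s → ∑ᵛ k λ t → f (merge S s t))
  ∑ᵛ-merge     zero    f []            = +-identityʳ _
  ∑ᵛ-merge {n} (suc k) f (inside  ∷ S) = begin
    n * n ^ k * sum (λ x → ∑ᵛ k (f′ x))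
      ≡⟨ *-assoc n (n ^ k) _ ⟩
    n * (n ^ k * sum (λ x → ∑ᵛ k (f′ x)))
      ≡⟨ cong (n *_) (*-distribˡ-sum (n ^ k) (λ x → ∑ᵛ k (f′ x))) ⟩
    n * sum (λ x → n ^ k * ∑ᵛ k (f′ x))
      ≡⟨ cong (n *_) (sum-cong-≗ λ x → ∑ᵛ-merge k (f′ x) S) ⟩
    n * sum (λ x → ∑ᵛ k λ s → ∑ᵛ k λ t → f′ x (merge S s t))
      ≡⟨ *-distribˡ-sum n (λ x → ∑ᵛ k λ s → ∑ᵛ k λ t → f′ x (merge S s t)) ⟩
    sum (λ x → n * ∑ᵛ k λ s → ∑ᵛ k λ t → f′ x (merge S s t))
      ≡⟨ (sum-cong-≗ λ x → trans (*-distribˡ-∑ᵛ k n (λ s → ∑ᵛ k λ t → f′ x (merge S s t)))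
           (∑ᵛ-cong k λ s → sym (sum-const n _))) ⟩
    sum (λ x → ∑ᵛ k λ s → ∑[ y < n ] ∑ᵛ k λ t → f′ x (merge S s t)) ∎
    where
    open ≡-Reasoning
    f′ = λ x s → f (x ∷ s)
  ∑ᵛ-merge {n} (suc k) f (outside ∷ S) = begin
    n * n ^ k * sum (λ y → ∑ᵛ k (f′ y))
      ≡⟨ *-assoc n (n ^ k) _ ⟩
    n * (n ^ k * sum (λ y → ∑ᵛ k (f′ y)))
      ≡⟨ cong (n *_) (*-distribˡ-sum (n ^ k) (λ y → ∑ᵛ k (f′ y))) ⟩
    n * sum (λ y → n ^ k * ∑ᵛ k (f′ y))
      ≡⟨ cong (n *_) (sum-cong-≗ λ y → ∑ᵛ-merge k (f′ y) S) ⟩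
    n * sum (λ y → ∑ᵛ k λ s → ∑ᵛ k λ t → f′ y (merge S s t))
      ≡⟨ cong (n *_) (sum-∑ᵛ-comm k λ y s → ∑ᵛ k λ t → f′ y (merge S s t)) ⟩
    n * ∑ᵛ k (λ s → sum λ y → ∑ᵛ k λ t → f′ y (merge S s t))
      ≡⟨ sum-const n _ ⟨
    ∑[ x < n ] ∑ᵛ k (λ s → sum λ y → ∑ᵛ k λ t → f′ y (merge S s t)) ∎
    where
    open ≡-Reasoning
    f′ = λ y s → f (y ∷ s)

-- Subsets, images under maps and injectivity

module Subsets where

  open import Data.Fin using (Fin; zero; suc)
  import Data.Fin.Properties as Fin
  open import Data.Fin.Subset using (Subset; inside; outside; _∈_; _∉_; _⊆_; ∣_∣; ⊥)
  open import Data.Fin.Subset.Properties using (_∈?_; ⊆-antisym; ∣⊥∣≡0)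
  open import Data.Nat using (ℕ; zero; suc; _≤_; _<_; z≤n; s≤s)
  open import Data.Nat.Properties using (≤-trans; n≤1+n; suc-injective; <⇒≢; ≤-reflexive; ≤-antisym)
  open import Data.Product using (∃-syntax; _×_; _,_)
  open import Data.Sum using (_⊎_; inj₁; inj₂)
  open import Data.Vec using (Vec; []; _∷_; lookup; tabulate; here; there; _[_]≔_)
  open import Data.Vec.Properties using (lookup∘tabulate; []=⇒lookup; lookup⇒[]=)
  open import Function using (_∘_; case_of_)
  open import Relation.Binary.PropositionalEquality
  open import Relation.Nullary using (Dec; does; yes; no; contradiction; _×-dec_)
  open import Relation.Nullary.Decidable using (dec-true)

  open import Defs using (image)
  open Sums

  private variable
    k m n v : ℕ
    A : Set

  ∣tabulate-does∣ : {P : Fin n → Set} (P? : ∀ x → Dec (P x)) →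
                    ∣ tabulate (does ∘ P?) ∣ ≡ ∑[ x < n ] 𝟙 (P? x)
  ∣tabulate-does∣ {zero}  P? = refl
  ∣tabulate-does∣ {suc n} P? with P? zero
  ... | yes _ = cong suc (∣tabulate-does∣ (P? ∘ suc))
  ... | no  _ = ∣tabulate-does∣ (P? ∘ suc)

  ∣S∣≡∑𝟙 : (S : Subset n) → ∣ S ∣ ≡ ∑[ x < n ] 𝟙 (x ∈? S)
  ∣S∣≡∑𝟙 []            = refl
  ∣S∣≡∑𝟙 (inside  ∷ S) = cong suc (trans (∣S∣≡∑𝟙 S)
    (sum-cong-≗ λ x → 𝟙-cong (x ∈? S) (suc x ∈? inside ∷ S) there λ { (there p) → p }))
  ∣S∣≡∑𝟙 (outside ∷ S) = trans (∣S∣≡∑𝟙 S)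
    (sum-cong-≗ λ x → 𝟙-cong (x ∈? S) (suc x ∈? outside ∷ S) there λ { (there p) → p })

  insert remove : Fin n → Subset n → Subset n
  insert v S = S [ v ]≔ inside
  remove v S = S [ v ]≔ outside

  ∈-insert : ∀ v (S : Subset n) → v ∈ insert v S
  ∈-insert zero    (_ ∷ S) = here
  ∈-insert (suc v) (_ ∷ S) = there (∈-insert v S)

  ∈-insert⁺ : ∀ {w} v (S : Subset n) → w ∈ S → w ∈ insert v S
  ∈-insert⁺ zero    (_ ∷ S) here      = here
  ∈-insert⁺ zero    (_ ∷ S) (there p) = there p
  ∈-insert⁺ (suc v) (_ ∷ S) here      = here
  ∈-insert⁺ (suc v) (_ ∷ S) (there p) = there (∈-insert⁺ v S p)

  ∈-insert⁻ : ∀ {w} v (S : Subset n) → w ∈ insert v S → w ≡ v ⊎ w ∈ S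
  ∈-insert⁻ zero    (_ ∷ S) here      = inj₁ refl
  ∈-insert⁻ zero    (_ ∷ S) (there p) = inj₂ (there p)
  ∈-insert⁻ (suc v) (_ ∷ S) here      = inj₂ here
  ∈-insert⁻ (suc v) (_ ∷ S) (there p) with ∈-insert⁻ v S p
  ... | inj₁ w≡v = inj₁ (cong suc w≡v)
  ... | inj₂ q   = inj₂ (there q)

  insert-absorb : ∀ {v} {S : Subset n} → v ∈ S → insert v S ≡ S
  insert-absorb here      = refl
  insert-absorb (there p) = cong (_ ∷_) (insert-absorb p)

  ∣insert∣ : ∀ v (S : Subset n) → v ∉ S → ∣ insert v S ∣ ≡ suc ∣ S ∣
  ∣insert∣ zero    (inside  ∷ S) v∉S = contradiction here v∉S
  ∣insert∣ zero    (outside ∷ S) v∉S = refl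
  ∣insert∣ (suc v) (inside  ∷ S) v∉S = cong suc (∣insert∣ v S (v∉S ∘ there))
  ∣insert∣ (suc v) (outside ∷ S) v∉S = ∣insert∣ v S (v∉S ∘ there)

  insert-remove : ∀ {v} {S : Subset n} → v ∈ S → insert v (remove v S) ≡ S
  insert-remove here      = refl
  insert-remove (there p) = cong (_ ∷_) (insert-remove p)

  ∉-remove : ∀ v (S : Subset n) → v ∉ remove v S
  ∉-remove (suc v) (_ ∷ S) (there p) = ∉-remove v S p

  ∣remove∣ : ∀ {v} {S : Subset n} → v ∈ S → ∣ S ∣ ≡ suc ∣ remove v S ∣
  ∣remove∣ {v = v} {S} v∈S = trans (cong ∣_∣ (sym (insert-remove v∈S))) (∣insert∣ v (remove v S) (∉-remove v S))

  nonempty : ∀ (S : Subset n) → 0 < ∣ S ∣ → ∃[ v ] v ∈ S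
  nonempty (inside  ∷ S) _ = zero , here
  nonempty (outside ∷ S) p with nonempty S p
  ... | v , v∈S = suc v , there v∈S

  subsetOfSize : k ≤ n → ∃[ S ] ∣_∣ {n} S ≡ k
  subsetOfSize {n = n} z≤n = ⊥ , ∣⊥∣≡0 n
  subsetOfSize (s≤s k≤n) with subsetOfSize k≤n
  ... | S , p = inside ∷ S , cong suc p

  ∈-image⁺ : ∀ (f : Fin m → Fin n) {e i} → i ∈ e → f i ∈ image f e
  ∈-image⁺ f {e} {i} i∈e = lookup⇒[]= (f i) _
    (trans (lookup∘tabulate _ (f i))
      (dec-true (Fin.any? λ i′ → (i′ ∈? e) ×-dec (f i′ Fin.≟ f i)) (i , i∈e , refl)))

  ∈-image⁻ : ∀ (f : Fin m → Fin n) {e j} → j ∈ image f e → ∃[ i ] (i ∈ e × f i ≡ j)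
  ∈-image⁻ f {e} {j} j∈
    with Fin.any? (λ i → (i ∈? e) ×-dec (f i Fin.≟ j)) | trans (sym (lookup∘tabulate _ j)) ([]=⇒lookup j∈)
  ... | yes p | _ = p

  image-local : ∀ {f g : Fin m → Fin n} e → (∀ {i} → i ∈ e → f i ≡ g i) → image f e ≡ image g e
  image-local {f = f} {g} e h = ⊆-antisym
    (λ p → let i , i∈e , q = ∈-image⁻ f p in subst (_∈ image g e) (trans (sym (h i∈e)) q) (∈-image⁺ g i∈e))
    (λ p → let i , i∈e , q = ∈-image⁻ g p in subst (_∈ image f e) (trans (h i∈e) q) (∈-image⁺ f i∈e))

  image-∘ : ∀ {l} (g : Fin m → Fin n) (f : Fin l → Fin m) e → image g (image f e) ≡ image (g ∘ f) e
  image-∘ g f e = ⊆-antisym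
    (λ p → let j , j∈ , q = ∈-image⁻ g p ; i , i∈e , q′ = ∈-image⁻ f j∈ in
      subst (_∈ image (g ∘ f) e) (trans (cong g q′) q) (∈-image⁺ (g ∘ f) i∈e))
    (λ p → let i , i∈e , q = ∈-image⁻ (g ∘ f) p in
      subst (_∈ image g (image f e)) q (∈-image⁺ g (∈-image⁺ f i∈e)))

  image-id : ∀ (e : Subset n) → image (λ x → x) e ≡ e
  image-id e = ⊆-antisym
    (λ p → let i , i∈e , q = ∈-image⁻ (λ x → x) p in subst (_∈ e) q i∈e)
    (∈-image⁺ (λ x → x))

  image-insert : ∀ (f : Fin m → Fin n) v S → image f (insert v S) ≡ insert (f v) (image f S)
  image-insert f v S = ⊆-antisym to from
    where
    to : image f (insert v S) ⊆ insert (f v) (image f S)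
    to p with ∈-image⁻ f p
    ... | i , i∈ , refl with ∈-insert⁻ v S i∈
    ...   | inj₁ refl = ∈-insert (f v) (image f S)
    ...   | inj₂ i∈S  = ∈-insert⁺ (f v) (image f S) (∈-image⁺ f i∈S)
    from : insert (f v) (image f S) ⊆ image f (insert v S)
    from p with ∈-insert⁻ (f v) (image f S) p
    ... | inj₁ refl = ∈-image⁺ f (∈-insert v S)
    ... | inj₂ q with ∈-image⁻ f q
    ...   | i , i∈S , refl = ∈-image⁺ f (∈-insert⁺ v S i∈S)

  image-inside : ∀ (f : Fin (suc m) → Fin n) S → image f (inside ∷ S) ≡ insert (f zero) (image (f ∘ suc) S)
  image-inside f S = trans (image-insert f zero (outside ∷ S)) (cong (insert (f zero)) (⊆-antisym
    (λ p → case⁻ (∈-image⁻ f {outside ∷ S} p))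
    (λ p → let i , i∈S , q = ∈-image⁻ (f ∘ suc) p in subst (_∈ _) q (∈-image⁺ f {outside ∷ S} (there i∈S)))))
    where
    case⁻ : ∀ {j} → ∃[ i ] (i ∈ outside ∷ S × f i ≡ j) → j ∈ image (f ∘ suc) S
    case⁻ (suc i , there i∈S , refl) = ∈-image⁺ (f ∘ suc) i∈S

  image-outside : ∀ (f : Fin (suc m) → Fin n) S → image f (outside ∷ S) ≡ image (f ∘ suc) S
  image-outside f S = ⊆-antisym
    (λ p → case⁻ (∈-image⁻ f {outside ∷ S} p))
    (λ p → let i , i∈S , q = ∈-image⁻ (f ∘ suc) p in subst (_∈ image f (outside ∷ S)) q (∈-image⁺ f {outside ∷ S} (there i∈S)))
    where
    case⁻ : ∀ {j} → ∃[ i ] (i ∈ outside ∷ S × f i ≡ j) → j ∈ image (f ∘ suc) S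
    case⁻ (suc i , there i∈S , refl) = ∈-image⁺ (f ∘ suc) i∈S

  ∣insert∣≤ : ∀ v (S : Subset n) → ∣ insert v S ∣ ≤ suc ∣ S ∣
  ∣insert∣≤ v S with v ∈? S
  ... | yes v∈S = subst (λ X → ∣ X ∣ ≤ suc ∣ S ∣) (sym (insert-absorb v∈S)) (n≤1+n _)
  ... | no  v∉S = ≤-reflexive (∣insert∣ v S v∉S)

  ∣image∣≤ : ∀ (f : Fin m → Fin n) S → ∣ image f S ∣ ≤ ∣ S ∣
  ∣image∣≤ {zero} {n} f [] = ≤-reflexive (empty n)
    where
    empty : ∀ n → ∣ tabulate {n = n} (λ _ → outside) ∣ ≡ 0
    empty zero    = refl
    empty (suc n) = empty n
  ∣image∣≤ {suc m} f (inside  ∷ S) rewrite image-inside f S =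
    ≤-trans (∣insert∣≤ (f zero) (image (f ∘ suc) S)) (s≤s (∣image∣≤ (f ∘ suc) S))
  ∣image∣≤ {suc m} f (outside ∷ S) rewrite image-outside f S = ∣image∣≤ (f ∘ suc) S

  InjectiveOn : (Fin m → Fin n) → Subset m → Set
  InjectiveOn f S = ∀ {x y} → x ∈ S → y ∈ S → f x ≡ f y → x ≡ y

  -- A collision would shrink the image. Through uniformity, this makes every homomorphism injective
  -- on each edge.
  ∣image∣≡⇒injectiveOn : ∀ (f : Fin m → Fin n) S → ∣ image f S ∣ ≡ ∣ S ∣ → InjectiveOn f S
  ∣image∣≡⇒injectiveOn {suc m} f (outside ∷ S) eq rewrite image-outside f S =
    λ { (there p) (there q) r → cong suc (∣image∣≡⇒injectiveOn (f ∘ suc) S eq p q r) }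
  ∣image∣≡⇒injectiveOn {suc m} f (inside ∷ S) eq rewrite image-inside f S = go
    where
    f₀∉ : f zero ∉ image (f ∘ suc) S
    f₀∉ p = <⇒≢ (s≤s (∣image∣≤ (f ∘ suc) S))
      (trans (cong ∣_∣ (sym (insert-absorb p))) eq)
    rec : InjectiveOn (f ∘ suc) S
    rec = ∣image∣≡⇒injectiveOn (f ∘ suc) S
      (suc-injective (trans (sym (∣insert∣ (f zero) (image (f ∘ suc) S) f₀∉)) eq))
    go : InjectiveOn f (inside ∷ S)
    go here      here      _ = refl
    go here      (there q) r = contradiction (subst (_∈ image (f ∘ suc) S) (sym r) (∈-image⁺ (f ∘ suc) q)) f₀∉
    go (there p) here      r = contradiction (subst (_∈ image (f ∘ suc) S) r (∈-image⁺ (f ∘ suc) p)) f₀∉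
    go (there p) (there q) r = cong suc (rec p q r)

  injectiveOn⇒∣image∣≡ : ∀ (f : Fin m → Fin n) S → InjectiveOn f S → ∣ image f S ∣ ≡ ∣ S ∣
  injectiveOn⇒∣image∣≡ {zero}  f [] inj = ≤-antisym (∣image∣≤ f []) z≤n
  injectiveOn⇒∣image∣≡ {suc m} f (outside ∷ S) inj rewrite image-outside f S =
    injectiveOn⇒∣image∣≡ (f ∘ suc) S λ p q r → Fin.suc-injective (inj (there p) (there q) r)
  injectiveOn⇒∣image∣≡ {suc m} f (inside ∷ S) inj rewrite image-inside f S = trans
    (∣insert∣ (f zero) (image (f ∘ suc) S) f₀∉)
    (cong suc (injectiveOn⇒∣image∣≡ (f ∘ suc) S λ p q r → Fin.suc-injective (inj (there p) (there q) r)))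
    where
    f₀∉ : f zero ∉ image (f ∘ suc) S
    f₀∉ p with ∈-image⁻ (f ∘ suc) p
    ... | i , i∈S , r = case inj (there i∈S) here r of λ ()

  -- The elements of `e` are dealt out along `U` one by one; the vertex argument fills the
  -- coordinates outside `U`.
  equinumerous⇒image : ∀ (U : Subset k) (e : Subset n) → ∣ U ∣ ≡ ∣ e ∣ → Fin n →
                       ∃[ s ] image (lookup s) U ≡ e
  equinumerous⇒image [] e p z = [] , ⊆-antisym
    (λ q → case⁻ (∈-image⁻ (lookup []) q))
    (λ {v} q → contradiction (trans p (∣remove∣ q)) λ ())
    where
    case⁻ : ∀ {j} → ∃[ i ] (i ∈ [] × lookup [] i ≡ j) → j ∈ e
    case⁻ (_ , () , _)
  equinumerous⇒image (outside ∷ U) e p z with equinumerous⇒image U e p z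
  ... | s , q = z ∷ s , trans (image-outside (lookup (z ∷ s)) U) q
  equinumerous⇒image (inside ∷ U) e p z with nonempty e (subst (0 <_) p (s≤s z≤n))
  ... | v , v∈e with equinumerous⇒image U (remove v e) (suc-injective (trans p (∣remove∣ v∈e))) z
  ...   | s , q = v ∷ s , trans (image-inside (lookup (v ∷ s)) U) (trans (cong (insert v) q) (insert-remove v∈e))

  lookup-merge-∈ : ∀ {S : Subset k} (s t : Vec A k) {i} → i ∈ S → lookup (merge S s t) i ≡ lookup s i
  lookup-merge-∈ {S = inside  ∷ S} (x ∷ s) (y ∷ t) here      = refl
  lookup-merge-∈ {S = inside  ∷ S} (x ∷ s) (y ∷ t) (there p) = lookup-merge-∈ s t p
  lookup-merge-∈ {S = outside ∷ S} (x ∷ s) (y ∷ t) (there p) = lookup-merge-∈ s t p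

  lookup-merge-∉ : ∀ {S : Subset k} (s t : Vec A k) {i} → i ∉ S → lookup (merge S s t) i ≡ lookup t i
  lookup-merge-∉ {S = inside  ∷ S} (x ∷ s) (y ∷ t) {zero}  i∉S = contradiction here i∉S
  lookup-merge-∉ {S = inside  ∷ S} (x ∷ s) (y ∷ t) {suc i} i∉S = lookup-merge-∉ s t (i∉S ∘ there)
  lookup-merge-∉ {S = outside ∷ S} (x ∷ s) (y ∷ t) {zero}  i∉S = refl
  lookup-merge-∉ {S = outside ∷ S} (x ∷ s) (y ∷ t) {suc i} i∉S = lookup-merge-∉ s t (i∉S ∘ there)

-- Co-degrees, homomorphisms and blow-ups

module Hypergraphs where

  open import Data.Bool using (Bool; true; false; T; T?)
  open import Data.Bool.Properties using (T-∧)
  open import Data.Fin using (Fin; zero; suc; _↑ˡ_; _↑ʳ_; splitAt)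
  import Data.Fin.Properties as Fin
  open import Data.Fin.Subset using (Subset; inside; outside; _∈_; _∉_; ∣_∣)
  open import Data.Fin.Subset.Properties using (_⊆?_; anySubset?; p⊆q⇒∣p∣≤∣q∣; drop-∷-⊆; out⊆; in⊆in)
  open import Data.List using ([]; _∷_; map; filter; length)
  open import Data.List.Properties using (filter-none; filter-++; length-++)
  open import Data.List.Membership.Propositional.Properties using (∈-map⁻)
  import Data.List.Relation.Unary.All as All
  open import Data.Nat using (ℕ; zero; suc; pred; NonZero; _+_; _*_; _/_; _%_; _≤_; _<_; z≤n; s≤s; _≟_)
  open import Data.Nat.DivMod using (m≡m%n+[m/n]*n; /-monoˡ-≤)
  open import Data.Nat.Properties
  open import Data.Product using (∃-syntax; _×_; _,_; proj₁; proj₂)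
  open import Data.Sum using (_⊎_; inj₁; inj₂; [_,_]′)
  open import Data.Vec using ([]; _∷_; here)
  open import Function using (_∘_; id; Equivalence)
  open import Relation.Binary.PropositionalEquality
  open import Relation.Nullary using (¬_; Dec; yes; no; contradiction; _×-dec_; _→-dec_)
  import Relation.Nullary.Decidable as Dec
  open import Relation.Unary using (Decidable)

  open import Defs hiding (_+_; _-_; -_; _<_)
  open Sums
  open Subsets

  private variable
    r k l m n v N : ℕ

  length-filter-map : ∀ {A B : Set} {P : B → Set} {Q : A → Set} (P? : Decidable P) (Q? : Decidable Q)
    (g : A → B) → (∀ x → P (g x) → Q x) → (∀ x → Q x → P (g x)) →
    ∀ xs → length (filter P? (map g xs)) ≡ length (filter Q? xs)
  length-filter-map P? Q? g to from [] = refl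
  length-filter-map P? Q? g to from (x ∷ xs) with P? (g x) | Q? x
  ... | yes _ | yes _ = cong suc (length-filter-map P? Q? g to from xs)
  ... | no  _ | no  _ = length-filter-map P? Q? g to from xs
  ... | yes p | no ¬q = contradiction (to x p) ¬q
  ... | no ¬p | yes q = contradiction (from x q) ¬p

  -- A co-degree for bare families of subsets. The induction on `n` splits a family by membership of
  -- `zero`, and the two slices of a uniform family have different uniformities.
  extensions : (Subset n → Bool) → Subset n → ℕ
  extensions {n} f S = length (filter (λ e → T? (f e) ×-dec (S ⊆? e)) (subsets n))

  extensions-∷ : ∀ (f : Subset (suc n) → Bool) S → extensions f S ≡
    length (filter (λ e → T? (f e) ×-dec (S ⊆? e)) (map (outside ∷_) (subsets n))) +
    length (filter (λ e → T? (f e) ×-dec (S ⊆? e)) (map (inside ∷_) (subsets n)))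
  extensions-∷ {n} f S = trans
    (cong length (filter-++ (λ e → T? (f e) ×-dec (S ⊆? e)) (map (outside ∷_) (subsets n)) _))
    (length-++ (filter (λ e → T? (f e) ×-dec (S ⊆? e)) (map (outside ∷_) (subsets n))))

  extensions-inside : ∀ (f : Subset (suc n) → Bool) S → extensions f (inside ∷ S) ≡ extensions (f ∘ (inside ∷_)) S
  extensions-inside {n} f S = trans (extensions-∷ f (inside ∷ S)) (cong₂ _+_
    (cong length (filter-none _ {xs = map (outside ∷_) (subsets n)} (All.tabulate λ e∈ (_ , S⊆e) →
      none (∈-map⁻ (outside ∷_) e∈) (S⊆e here))))
    (length-filter-map _ _ (inside ∷_)
      (λ e (p , q) → p , drop-∷-⊆ q) (λ e (p , q) → p , in⊆in q) (subsets n)))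
    where
    none : ∀ {e} → ∃[ e′ ] (_ × e ≡ outside ∷ e′) → ¬ (zero ∈ e)
    none (_ , _ , refl) ()

  extensions-outside : ∀ (f : Subset (suc n) → Bool) S → extensions f (outside ∷ S) ≡
    extensions (f ∘ (outside ∷_)) S + extensions (f ∘ (inside ∷_)) S
  extensions-outside {n} f S = trans (extensions-∷ f (outside ∷ S)) (cong₂ _+_
    (length-filter-map _ _ (outside ∷_)
      (λ e (p , q) → p , drop-∷-⊆ q) (λ e (p , q) → p , out⊆ q) (subsets n))
    (length-filter-map _ _ (inside ∷_)
      (λ e (p , q) → p , drop-∷-⊆ q) (λ e (p , q) → p , out⊆ q) (subsets n)))

  extensions-none : ∀ (f : Subset n → Bool) S → (∀ e → T (f e) → ∣ e ∣ < ∣ S ∣) → extensions f S ≡ 0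
  extensions-none {n} f S h = cong length (filter-none _ {xs = subsets n}
    (All.tabulate λ {e} _ (p , q) → <⇒≱ (h e p) (p⊆q⇒∣p∣≤∣q∣ q)))

  extensions-same : ∀ (f : Subset n → Bool) S → (∀ e → T (f e) → ∣ e ∣ ≡ ∣ S ∣) → extensions f S ≡ 𝟙 (T? (f S))
  extensions-same f [] h with f []
  ... | true  = refl
  ... | false = refl
  extensions-same f (inside ∷ S) h = trans (extensions-inside f S)
    (extensions-same (f ∘ (inside ∷_)) S λ e p → suc-injective (h _ p))
  extensions-same f (outside ∷ S) h = trans (extensions-outside f S) (trans (cong₂ _+_
    (extensions-same (f ∘ (outside ∷_)) S λ e p → h _ p)
    (extensions-none (f ∘ (inside ∷_)) S λ e p → ≤-reflexive (h _ p)))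
    (+-identityʳ _))

  -- A superset with one more element is `insert v S` for a unique `v` outside `S`; for `v` in `S`
  -- the insertion changes nothing, and `S` is too small to be a member.
  extensions-suc : ∀ (f : Subset n → Bool) S → (∀ e → T (f e) → ∣ e ∣ ≡ suc ∣ S ∣) →
                   extensions f S ≡ ∑[ v < n ] 𝟙 (T? (f (insert v S)))
  extensions-suc f [] h = extensions-empty (f []) refl
    where
    extensions-empty : ∀ b → f [] ≡ b → extensions f [] ≡ 0
    extensions-empty true  eq = contradiction (h [] (subst T (sym eq) _)) λ ()
    extensions-empty false eq rewrite eq = refl
  extensions-suc f (inside ∷ S) h = trans (extensions-inside f S) (trans
    (extensions-suc (f ∘ (inside ∷_)) S λ e p → suc-injective (h _ p))
    (sym (cong (_+ (∑[ v < _ ] 𝟙 (T? (f (inside ∷ insert v S))))) (𝟙-no (T? (f (inside ∷ S))) λ p → 1+n≢n (sym (h _ p))))))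
  extensions-suc f (outside ∷ S) h = trans (extensions-outside f S) (trans (+-comm (extensions (f ∘ (outside ∷_)) S) _)
    (cong₂ _+_
    (extensions-same (f ∘ (inside ∷_)) S λ e p → suc-injective (h _ p))
    (extensions-suc (f ∘ (outside ∷_)) S λ e p → h _ p)))

  codegree≡ : ∀ (H : RGraph (suc r) n) S → ∣ S ∣ ≡ r →
              codegree H S ≡ ∑[ v < n ] 𝟙 (Edge? H (insert v S))
  codegree≡ H S ∣S∣ = extensions-suc (edge H) S λ e p → trans (uniform H e p) (cong suc (sym ∣S∣))

  edge⇒Positive : (H : RGraph r n) → ∀ {e} → Edge H e → ∃[ S ] Positive H S
  edge⇒Positive H {e} p with subset-pred e
  ... | S , ∣S∣ , S⊆e = S , trans ∣S∣ (cong pred (uniform H e p)) , e , p , S⊆e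

  anyEdge? : (H : RGraph r n) → Dec (∃[ e ] Edge H e)
  anyEdge? H = anySubset? (Edge? H)

  δ⁺≤n : (H : RGraph (suc r) n) → δ⁺ H ≤ n
  δ⁺≤n {n = n} H with anyEdge? H
  ... | no ¬e = subst (_≤ n) (sym (δ⁺-edgeless H ¬e)) z≤n
  ... | yes (e , p) with edge⇒Positive H p
  ...   | S , pos = begin
    δ⁺ H                                   ≤⟨ δ⁺-bound H S pos ⟩
    codegree H S                           ≡⟨ codegree≡ H S (proj₁ pos) ⟩
    ∑[ v < n ] 𝟙 (Edge? H (insert v S))    ≤⟨ sum-mono (λ v → 𝟙≤1 (Edge? H (insert v S))) ⟩
    ∑[ v < n ] 1                           ≡⟨ sum-const n 1 ⟩
    n * 1                                  ≡⟨ *-identityʳ n ⟩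
    n                                      ∎
    where open ≤-Reasoning

  Hom : RGraph r m → RGraph r n → (Fin m → Fin n) → Set
  Hom F H f = ∀ e → Edge F e → Edge H (image f e)

  Hom? : (F : RGraph r m) (H : RGraph r n) → ∀ f → Dec (Hom F H f)
  Hom? {m = m} F H f = Dec.map′
    (λ p e → All.lookup p (subsets-complete e)) (λ p → All.tabulate λ {e} _ → p e)
    (All.all? (λ e → Edge? F e →-dec Edge? H (image f e)) (subsets m))

  -- The list `functions m n` contains each map only up to pointwise equality, so deciding `HomFree`
  -- requires this invariance.
  Hom-cong : (F : RGraph r m) (H : RGraph r n) → ∀ {f g} → f ≗ g → Hom F H f → Hom F H g
  Hom-cong F H f≗g hom e p = subst (Edge H) (image-cong f≗g e) (hom e p)

  HomFree : RGraph r m → RGraph r n → Set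
  HomFree F H = ∀ f → ¬ Hom F H f

  HomFree? : (F : RGraph r m) (H : RGraph r n) → Dec (HomFree F H)
  HomFree? {m = m} {n = n} F H = Dec.map′
    (λ all f hom → let g , g∈ , f≗g = functions-complete f in All.lookup all g∈ (Hom-cong F H f≗g hom))
    (λ free → All.tabulate λ {f} _ → free f)
    (All.all? (λ f → Dec.¬? (Hom? F H f)) (functions m n))

  HomFree⇒Free : (F : RGraph r m) (H : RGraph r n) → HomFree F H → Free F H
  HomFree⇒Free F H free (f , _ , hom) = free f hom

  module _ (H : RGraph r v) (c : Fin N → Fin v) where

    blowup-edge⁺ : ∀ e → ∣ e ∣ ≡ r → Edge H (image c e) → Edge (blowup H c) e
    blowup-edge⁺ e p q = Equivalence.from T-∧ (Dec.fromWitness p , q)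

    blowup-edge⁻ : ∀ e → Edge (blowup H c) e → Edge H (image c e)
    blowup-edge⁻ e p = proj₂ (Equivalence.to (T-∧ {Dec.⌊ ∣ e ∣ ≟ r ⌋}) p)

    -- Composition with the class map sends a homomorphism into the blow-up to one into `H`. The
    -- composite may identify vertices, which is why plain `F`-freeness would not suffice here.
    blowup-HomFree : (F : RGraph r m) → HomFree F H → HomFree F (blowup H c)
    blowup-HomFree F free f hom = free (c ∘ f) λ e p →
      subst (Edge H) (image-∘ c f e) (blowup-edge⁻ _ (hom e p))

    blowup-injectiveOn : ∀ e → Edge (blowup H c) e → InjectiveOn c e
    blowup-injectiveOn e p = ∣image∣≡⇒injectiveOn c e
      (trans (uniform H _ (blowup-edge⁻ e p)) (sym (uniform (blowup H c) e p)))

    -- The class map is injective on the edge that contains `S`, hence on `S`, so projecting keeps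
    -- the size.
    blowup-Positive : ∀ S → Positive (blowup H c) S → Positive H (image c S)
    blowup-Positive S (∣S∣ , e , p , S⊆e) =
      trans (injectiveOn⇒∣image∣≡ c S (λ a b → blowup-injectiveOn e p (S⊆e a) (S⊆e b))) ∣S∣ ,
      image c e , blowup-edge⁻ e p ,
      λ q → let i , i∈S , eq = ∈-image⁻ c q in subst (_∈ image c e) eq (∈-image⁺ c (S⊆e i∈S))

  blowup-codegree : (H : RGraph (suc r) v) (c : Fin N → Fin v) → ∀ S → Positive (blowup H c) S →
                    ∑[ x < N ] 𝟙 (Edge? H (insert (c x) (image c S))) ≤ codegree (blowup H c) S
  blowup-codegree {r} {N = N} H c S pos = begin
    ∑[ x < N ] 𝟙 (Edge? H (insert (c x) (image c S)))
      ≤⟨ sum-mono (λ x → 𝟙-mono (Edge? H (insert (c x) (image c S))) (Edge? (blowup H c) (insert x S)) (lift x)) ⟩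
    ∑[ x < N ] 𝟙 (Edge? (blowup H c) (insert x S))
      ≡⟨ codegree≡ (blowup H c) S (proj₁ pos) ⟨
    codegree (blowup H c) S ∎
    where
    open ≤-Reasoning
    lift : ∀ x → Edge H (insert (c x) (image c S)) → Edge (blowup H c) (insert x S)
    lift x p = blowup-edge⁺ H c (insert x S) (trans (∣insert∣ x S x∉S) (cong suc (proj₁ pos)))
      (subst (Edge H) (sym (image-insert c x S)) p)
      where
      -- If `x` were in `S`, its class would already occur in `image c S`, and the supposed edge
      -- would have only `r` elements.
      x∉S : x ∉ S
      x∉S x∈S = 1+n≢n (trans (sym (uniform H _ p))
        (trans (cong ∣_∣ (insert-absorb (∈-image⁺ c x∈S))) (proj₁ (blowup-Positive H c S pos))))

  classSize : (Fin N → Fin v) → Fin v → ℕ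
  classSize {N} c i = ∑[ x < N ] 𝟙 (c x Fin.≟ i)

  ∑-singleton : ∀ (i : Fin n) (f : Fin n → ℕ) → ∑[ j < n ] (𝟙 (i Fin.≟ j) * f j) ≡ f i
  ∑-singleton {suc n} zero f = trans (cong₂ _+_ (+-identityʳ (f zero))
    (trans (sum-const n 0) (*-zeroʳ n))) (+-identityʳ (f zero))
  ∑-singleton {suc n} (suc i) f = trans
    (sum-cong-≗ λ j → cong (_* f (suc j)) (𝟙-cong (suc i Fin.≟ suc j) (i Fin.≟ j) Fin.suc-injective (cong suc)))
    (∑-singleton i (f ∘ suc))

  ∑-by-class : ∀ (c : Fin N → Fin v) (f : Fin v → ℕ) →
               ∑[ x < N ] f (c x) ≡ ∑[ i < v ] (classSize c i * f i)
  ∑-by-class {N} {v} c f = begin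
    ∑[ x < N ] f (c x)                                  ≡⟨ sum-cong-≗ (λ x → ∑-singleton (c x) f) ⟨
    ∑[ x < N ] ∑[ i < v ] (𝟙 (c x Fin.≟ i) * f i)       ≡⟨ ∑-comm (λ x i → 𝟙 (c x Fin.≟ i) * f i) ⟩
    ∑[ i < v ] ∑[ x < N ] (𝟙 (c x Fin.≟ i) * f i)       ≡⟨ sum-cong-≗ (λ i → *-distribʳ-sum (f i) (λ x → 𝟙 (c x Fin.≟ i))) ⟨
    ∑[ i < v ] (classSize c i * f i)                    ∎
    where open ≡-Reasoning

  classSize-pos⇒preimage : ∀ (c : Fin N → Fin v) i → 0 < classSize c i → ∃[ x ] c x ≡ i
  classSize-pos⇒preimage {N} c i p with sum-<⇒∃< (λ _ → 0) (λ x → 𝟙 (c x Fin.≟ i))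
    (subst (_< classSize c i) (sym (trans (sum-const N 0) (*-zeroʳ N))) p)
  ... | x , q = x , 0<𝟙⇒ (c x Fin.≟ i) q

  -- Each vertex of `H` that completes the projected set to an edge contributes its whole class. For
  -- positive `L` all classes are inhabited, so a section of `c` lifts an edge, as `δ⁺-greatest`
  -- requires; empty classes could destroy every edge, whence the separate case `L = 0`.
  δ⁺-blowup : (H : RGraph (suc r) v) (c : Fin N → Fin v) → ∀ L → (∀ i → L ≤ classSize c i) →
              δ⁺ H * L ≤ δ⁺ (blowup H c)
  δ⁺-blowup {r} {v} {N} H c zero h = subst (_≤ δ⁺ (blowup H c)) (sym (*-zeroʳ (δ⁺ H))) z≤n
  δ⁺-blowup {r} {v} {N} H c L@(suc _) h with anyEdge? H
  ... | no ¬e = subst (λ d → d * L ≤ δ⁺ (blowup H c)) (sym (δ⁺-edgeless H ¬e)) z≤n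
  ... | yes (e , p) = δ⁺-greatest (blowup H c) (image σ e , e′-edge) (δ⁺ H * L) bound
    where
    preimage : ∀ i → ∃[ x ] c x ≡ i
    preimage i = classSize-pos⇒preimage c i (≤-trans (s≤s z≤n) (h i))
    σ : Fin v → Fin N
    σ i = proj₁ (preimage i)
    c∘σ : ∀ i → c (σ i) ≡ i
    c∘σ i = proj₂ (preimage i)
    e′-edge : Edge (blowup H c) (image σ e)
    e′-edge = blowup-edge⁺ H c (image σ e)
      (trans (injectiveOn⇒∣image∣≡ σ e (λ {x} {y} _ _ q → trans (sym (c∘σ x)) (trans (cong c q) (c∘σ y)))) (uniform H e p))
      (subst (Edge H) (sym (trans (image-∘ c σ e) (trans (image-cong c∘σ e) (image-id e)))) p)
    open ≤-Reasoning
    bound : ∀ S → Positive (blowup H c) S → δ⁺ H * L ≤ codegree (blowup H c) S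
    bound S pos = begin
      δ⁺ H * L
        ≤⟨ *-monoˡ-≤ L (δ⁺-bound H S′ pos′) ⟩
      codegree H S′ * L
        ≡⟨ cong (_* L) (codegree≡ H S′ (proj₁ pos′)) ⟩
      ∑[ i < v ] 𝟙 (Edge? H (insert i S′)) * L
        ≡⟨ *-distribʳ-sum L (λ i → 𝟙 (Edge? H (insert i S′))) ⟩
      ∑[ i < v ] (𝟙 (Edge? H (insert i S′)) * L)
        ≤⟨ sum-mono (λ i → ≤-trans (*-monoʳ-≤ (𝟙 (Edge? H (insert i S′))) (h i)) (≤-reflexive (*-comm (𝟙 (Edge? H (insert i S′))) _))) ⟩
      ∑[ i < v ] (classSize c i * 𝟙 (Edge? H (insert i S′)))
        ≡⟨ ∑-by-class c (λ i → 𝟙 (Edge? H (insert i S′))) ⟨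
      ∑[ x < N ] 𝟙 (Edge? H (insert (c x) S′))
        ≤⟨ blowup-codegree H c S pos ⟩
      codegree (blowup H c) S ∎
      where
      S′ = image c S
      pos′ = blowup-Positive H c S pos

  Balanced⇒classSize : .{{_ : NonZero v}} (c : Fin N → Fin v) → Balanced c → ∀ i → N / v ≤ classSize c i
  Balanced⇒classSize {v} {N} c bal i = subst (N / v ≤_) (∣tabulate-does∣ (λ x → c x Fin.≟ i)) (go (bal i))
    where
    go : ∣ vertexClass c i ∣ ≡ ⌊ N / v ⌋ ⊎ ∣ vertexClass c i ∣ ≡ ⌈ N / v ⌉ → N / v ≤ ∣ vertexClass c i ∣
    go (inj₁ p) = ≤-reflexive (sym p)
    go (inj₂ p) = ≤-trans (/-monoˡ-≤ v (m≤m+n N (pred v))) (≤-reflexive (sym p))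

  -- `L` full rounds through all classes, with the `R` leftover vertices put into class `z`; the aim
  -- is a lower bound on every class.
  fromCopies : ∀ L R → Fin v → Fin (L * v + R) → Fin v
  fromCopies {v} zero    R z _ = z
  fromCopies {v} (suc L) R z x = [ id , fromCopies L R z ]′ (splitAt v (subst Fin (+-assoc v (L * v) R) x))

  classSize-fromCopies : ∀ L R (z i : Fin v) → L ≤ classSize (fromCopies L R z) i
  classSize-fromCopies         zero    R z i = z≤n
  classSize-fromCopies {v} (suc L) R z i = begin
    1 + L
      ≤⟨ +-mono-≤ (≤-trans (≤-reflexive (sym (𝟙-yes (i Fin.≟ i) refl))) (term≤sum (λ x → 𝟙 (x Fin.≟ i)) i))
                  (classSize-fromCopies L R z i) ⟩
    ∑[ x < v ] 𝟙 (x Fin.≟ i) + classSize (fromCopies L R z) i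
      ≡⟨ cong₂ _+_ (sum-cong-≗ λ x → cong (λ y → 𝟙 ([ id , fromCopies L R z ]′ y Fin.≟ i)) (sym (Fin.splitAt-↑ˡ v x (L * v + R))))
                   (sum-cong-≗ λ x → cong (λ y → 𝟙 ([ id , fromCopies L R z ]′ y Fin.≟ i)) (sym (Fin.splitAt-↑ʳ v (L * v + R) x))) ⟩
    ∑[ x < v ] g (x ↑ˡ (L * v + R)) + ∑[ x < L * v + R ] g (v ↑ʳ x)
      ≡⟨ sum-↑ v (L * v + R) g ⟨
    sum g
      ≡⟨ reindex (+-assoc v (L * v) R) g ⟩
    classSize (fromCopies (suc L) R z) i ∎
    where
    open ≤-Reasoning
    g : Fin (v + (L * v + R)) → ℕ
    g x = 𝟙 ([ id , fromCopies L R z ]′ (splitAt v x) Fin.≟ i)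
    reindex : ∀ {a b} (eq : b ≡ a) (g : Fin a → ℕ) → sum g ≡ sum (g ∘ subst Fin eq)
    reindex refl g = refl

  ∃-equitable : .{{_ : NonZero v}} → ∀ N → ∃[ c ] (∀ (i : Fin v) → N / v ≤ classSize {N} c i)
  ∃-equitable {v@(suc _)} N = subst (λ N′ → ∃[ c ] (∀ (i : Fin v) → N / v ≤ classSize {N′} c i))
    (sym (trans (m≡m%n+[m/n]*n N v) (+-comm (N % v) _)))
    (fromCopies (N / v) (N % v) zero , classSize-fromCopies (N / v) (N % v) zero)

-- Supersaturation: homomorphism counts in an `F`-free hypergraph

module HomCount where

  open import Data.Fin using (Fin; zero; suc)
  import Data.Fin.Properties as Fin
  open import Data.Fin.Subset using (_∈_)
  open import Data.Fin.Subset.Properties using (_∈?_)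
  open import Data.List using ([]; _∷_; length; allFin)
  open import Data.List.Properties using (length-tabulate)
  open import Data.List.Membership.Propositional using () renaming (_∈_ to _∈ˡ_)
  open import Data.List.Membership.Propositional.Properties using (∈-allFin)
  open import Data.List.Relation.Unary.Any using (here; there)
  open import Data.Nat using (ℕ; zero; suc; NonZero; _*_; _^_; _≤_; _<_; z≤n)
  open import Data.Nat.Properties
  open import Data.Nat.Tactic.RingSolver using (solve-∀)
  open import Data.Product using (∃-syntax; Σ-syntax; _×_; _,_; proj₂)
  open import Data.Sum using (_⊎_; inj₁; inj₂)
  open import Data.Vec using (Vec; []; _∷_; lookup; _[_]≔_)
  open import Data.Vec.Properties using (lookup∘update; lookup∘update′; []≔-idempotent)
  open import Function using (_∘_; Injective)
  open import Relation.Binary.PropositionalEquality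
  open import Relation.Nullary using (¬_; Dec; yes; no; contradiction; _×-dec_; ¬?)
  open import Relation.Nullary.Decidable using (decidable-stable)

  open import Defs hiding (_+_; _-_; -_; _<_)
  open Sums
  open Subsets
  open Hypergraphs

  private variable
    r k m n : ℕ

  -- A labelling `g` prescribes a type of homomorphism: vertices of `F` with equal labels get equal
  -- images. Splitting gives `x` the fresh label `zero`. Its old label survives as a coordinate,
  -- possibly carried by no vertex, which leaves densities unaffected.
  split : (Fin m → Fin k) → Fin m → Fin m → Fin (suc k)
  split g x y with y Fin.≟ x
  ... | yes _ = zero
  ... | no  _ = suc (g y)

  split-≡ : ∀ (g : Fin m → Fin k) x → split g x x ≡ zero
  split-≡ g x with x Fin.≟ x
  ... | yes _   = refl
  ... | no  x≢x = contradiction refl x≢x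

  split-≢ : ∀ (g : Fin m → Fin k) {x y} → y ≢ x → split g x y ≡ suc (g y)
  split-≢ g {x} {y} y≢x with y Fin.≟ x
  ... | yes y≡x = contradiction y≡x y≢x
  ... | no  _   = refl

  Separated : (Fin m → Fin k) → Fin m → Set
  Separated g x = ∀ y → y ≢ x → g y ≢ g x

  split-Separated : ∀ (g : Fin m → Fin k) x → Separated (split g x) x
  split-Separated g x y y≢x eq = contradiction (trans (sym (split-≢ g y≢x)) (trans eq (split-≡ g x))) λ ()

  split-preserves-Separated : ∀ (g : Fin m → Fin k) x {z} → Separated g z → Separated (split g x) z
  split-preserves-Separated g x {z} sep y y≢z eq with z Fin.≟ x
  ... | yes refl = split-Separated g x y y≢z (trans eq (sym (split-≡ g x)))
  ... | no  z≢x with y Fin.≟ x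
  ...   | yes refl = contradiction eq λ ()
  ...   | no  y≢x  = sep y y≢z (Fin.suc-injective eq)

  module _ (F : RGraph r m) (H : RGraph r n) where

    homCount : (Fin m → Fin k) → ℕ
    homCount {k} g = ∑ᵛ k λ s → 𝟙 (Hom? F H (lookup s ∘ g))

    -- Two homomorphisms that differ only at the label of `x` can be combined. An edge without `x`
    -- follows the first. An edge through `x` follows the second, because injectivity on edges
    -- forbids another of its vertices to share the label of `x`.
    Hom-split : ∀ (g : Fin m → Fin k) x (s : Vec (Fin n) k) z →
                Hom F H (lookup s ∘ g) → Hom F H (lookup (s [ g x ]≔ z) ∘ g) →
                Hom F H (lookup (z ∷ s) ∘ split g x)
    Hom-split g x s z hom hom′ e p with x ∈? e
    ... | no x∉e = subst (Edge H) (image-local e agree) (hom e p)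
      where
      agree : ∀ {y} → y ∈ e → lookup s (g y) ≡ lookup (z ∷ s) (split g x y)
      agree {y} y∈e = cong (lookup (z ∷ s)) (sym (split-≢ g λ { refl → x∉e y∈e }))
    ... | yes x∈e = subst (Edge H) (image-local e agree) (hom′ e p)
      where
      inj : InjectiveOn (lookup s ∘ g) e
      inj = ∣image∣≡⇒injectiveOn (lookup s ∘ g) e (trans (uniform H _ (hom e p)) (sym (uniform F e p)))
      agree : ∀ {y} → y ∈ e → lookup (s [ g x ]≔ z) (g y) ≡ lookup (z ∷ s) (split g x y)
      agree {y} y∈e with y Fin.≟ x
      ... | yes refl = lookup∘update (g x) s z
      ... | no  y≢x  = lookup∘update′ (λ eq → y≢x (inj y∈e x∈e (cong (lookup s) eq))) s z

    -- In densities: splitting a vertex at worst squares the density. If `d s` counts the good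
    -- values at label `g x`, ordered pairs of good values give homomorphisms of the split type, and
    -- Cauchy-Schwarz bounds the sum of `d s * d s` from below.
    homCount-split : .{{_ : NonZero n}} → ∀ (g : Fin m → Fin k) x →
                     n * (homCount g * homCount g) ≤ n ^ k * homCount (split g x)
    homCount-split {k = k} g x = *-cancelˡ-≤ n (begin
      n * (n * (homCount g * homCount g))
        ≡⟨ regroup n (homCount g) ⟩
      (n * homCount g) * (n * homCount g)
        ≡⟨ cong₂ _*_ (∑ᵛ-resample k a (g x)) (∑ᵛ-resample k a (g x)) ⟩
      ∑ᵛ k d * ∑ᵛ k d
        ≤⟨ cauchy-schwarzᵛ k d ⟩
      n ^ k * ∑ᵛ k (λ s → d s * d s)
        ≡⟨ cong (n ^ k *_) (∑ᵛ-cong k λ s → *-distribʳ-sum (d s) (λ z → a (s [ g x ]≔ z))) ⟩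
      n ^ k * ∑ᵛ k (λ s → ∑[ z < n ] (a (s [ g x ]≔ z) * d s))
        ≡⟨ cong (n ^ k *_) (∑ᵛ-cong k λ s → sum-cong-≗ λ z → cong (a (s [ g x ]≔ z) *_) (d-update s z)) ⟨
      n ^ k * ∑ᵛ k (λ s → ∑[ z < n ] (a (s [ g x ]≔ z) * d (s [ g x ]≔ z)))
        ≡⟨ cong (n ^ k *_) (∑ᵛ-resample k (λ s → a s * d s) (g x)) ⟨
      n ^ k * (n * ∑ᵛ k (λ s → a s * d s))
        ≡⟨ exchange (n ^ k) n _ ⟩
      n * (n ^ k * ∑ᵛ k (λ s → a s * d s))
        ≡⟨ cong (λ y → n * (n ^ k * y)) (∑ᵛ-cong k λ s → *-distribˡ-sum (a s) (λ z → a (s [ g x ]≔ z))) ⟩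
      n * (n ^ k * ∑ᵛ k (λ s → ∑[ z < n ] (a s * a (s [ g x ]≔ z))))
        ≡⟨ cong (λ y → n * (n ^ k * y)) (sum-∑ᵛ-comm k λ z s → a s * a (s [ g x ]≔ z)) ⟨
      n * (n ^ k * ∑[ z < n ] ∑ᵛ k (λ s → a s * a (s [ g x ]≔ z)))
        ≤⟨ *-monoʳ-≤ n (*-monoʳ-≤ (n ^ k) (sum-mono λ z → ∑ᵛ-mono k λ s → both s z)) ⟩
      n * (n ^ k * homCount (split g x)) ∎)
      where
      open ≤-Reasoning
      a d : Vec (Fin n) k → ℕ
      a s = 𝟙 (Hom? F H (lookup s ∘ g))
      d s = ∑[ z < n ] a (s [ g x ]≔ z)
      -- `d` ignores the coordinate `g x`, so `d s * d s` is a resampled sum of `a s * d s`, and one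
      -- factor `n` comes back.
      d-update : ∀ s z → d (s [ g x ]≔ z) ≡ d s
      d-update s z = sum-cong-≗ {n} λ y → cong a ([]≔-idempotent {x = z} {y = y} s (g x))
      both : ∀ s z → a s * a (s [ g x ]≔ z) ≤ 𝟙 (Hom? F H (lookup (z ∷ s) ∘ split g x))
      both s z = 𝟙-*-≤ (Hom? F H (lookup s ∘ g)) (Hom? F H (lookup (s [ g x ]≔ z) ∘ g)) λ p q →
        ≤-reflexive (sym (𝟙-yes (Hom? F H (lookup (z ∷ s) ∘ split g x)) (Hom-split g x s z p q)))
      regroup : ∀ n h → n * (n * (h * h)) ≡ (n * h) * (n * h)
      regroup = solve-∀
      exchange : ∀ x y z → x * (y * z) ≡ y * (x * z)
      exchange = solve-∀

    dense-split : .{{_ : NonZero n}} → ∀ (g : Fin m → Fin k) x C →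
                  n ^ k < C * homCount g → n ^ suc k < C * C * homCount (split g x)
    dense-split {k = k} g x C h = *-cancelˡ-< (n ^ k) _ _ (begin-strict
      n ^ k * (n * n ^ k)                        ≡⟨ exchange (n ^ k) n (n ^ k) ⟩
      n * (n ^ k * n ^ k)                        <⟨ *-monoʳ-< n (*-mono-< h h) ⟩
      n * ((C * homCount g) * (C * homCount g))  ≡⟨ collect n C (homCount g) ⟩
      C * C * (n * (homCount g * homCount g))    ≤⟨ *-monoʳ-≤ (C * C) (homCount-split g x) ⟩
      C * C * (n ^ k * homCount (split g x))     ≡⟨ exchange (C * C) (n ^ k) _ ⟩
      n ^ k * (C * C * homCount (split g x))     ∎)
      where
      open ≤-Reasoning
      exchange : ∀ x y z → x * (y * z) ≡ y * (x * z)
      exchange = solve-∀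
      collect : ∀ n C h → n * ((C * h) * (C * h)) ≡ C * C * (n * (h * h))
      collect = solve-∀

  -- This is `C ^ (2 ^ j)`, the inverse density after `j` splits.
  iteratedSquare : ℕ → ℕ → ℕ
  iteratedSquare zero    C = C
  iteratedSquare (suc j) C = iteratedSquare j (C * C)

  -- The disjunction is the invariant of the recursion: a vertex becomes separated at its turn, and
  -- later splits keep it so. Once every vertex is separated, the labelling is injective.
  dense-splits : .{{_ : NonZero n}} → ∀ (F : RGraph r m) (H : RGraph r n) xs (g : Fin m → Fin k) C →
    n ^ k < C * homCount F H g →
    ∃[ k′ ] Σ[ g′ ∈ (Fin m → Fin k′) ]
      ( n ^ k′ < iteratedSquare (length xs) C * homCount F H g′
      × (∀ {y} → y ∈ˡ xs ⊎ Separated g y → Separated g′ y))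
  dense-splits F H []       g C h = _ , g , h , λ { (inj₂ sep) → sep }
  dense-splits {m = m} F H (x ∷ xs) g C h =
    let k′ , g′ , h′ , sep = dense-splits F H xs (split g x) (C * C) (dense-split F H g x C h)
    in k′ , g′ , h′ , λ y∈⊎sep → sep (step y∈⊎sep)
    where
    step : ∀ {y} → y ∈ˡ x ∷ xs ⊎ Separated g y → y ∈ˡ xs ⊎ Separated (split g x) y
    step (inj₁ (here refl)) = inj₂ (split-Separated g x)
    step (inj₁ (there y∈))  = inj₁ y∈
    step (inj₂ s)           = inj₂ (split-preserves-Separated g x s)

  -- Redraw entry `j`: exactly one of the `n` values agrees with entry `i`.
  ∑ᵛ-coincidence : ∀ k (i j : Fin k) → i ≢ j →
                   n * ∑ᵛ {n} k (λ s → 𝟙 (lookup s i Fin.≟ lookup s j)) ≡ n ^ k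
  ∑ᵛ-coincidence {n} k i j i≢j = begin
    n * ∑ᵛ k (λ s → 𝟙 (lookup s i Fin.≟ lookup s j))
      ≡⟨ ∑ᵛ-resample k (λ s → 𝟙 (lookup s i Fin.≟ lookup s j)) j ⟩
    ∑ᵛ k (λ s → ∑[ z < n ] 𝟙 (lookup (s [ j ]≔ z) i Fin.≟ lookup (s [ j ]≔ z) j))
      ≡⟨ (∑ᵛ-cong k λ s → trans (sum-cong-≗ λ z → trans
           (cong₂ (λ u w → 𝟙 (u Fin.≟ w)) (lookup∘update′ i≢j s z) (lookup∘update j s z))
           (sym (*-identityʳ _)))
           (∑-singleton (lookup s i) (λ _ → 1))) ⟩
    ∑ᵛ {n} k (λ _ → 1)
      ≡⟨ ∑ᵛ-const k 1 ⟩
    n ^ k * 1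
      ≡⟨ *-identityʳ _ ⟩
    n ^ k ∎
    where open ≡-Reasoning

  -- In an `F`-free hypergraph each homomorphism must identify two vertices of `F`. Their labels
  -- differ, so each of at most `m * m` pairs collides in one tuple out of `n`.
  Free⇒homCount-injective : ∀ (F : RGraph r m) (H : RGraph r n) → Free F H →
    ∀ (g : Fin m → Fin k) → Injective _≡_ _≡_ g → n * homCount F H g ≤ m * m * n ^ k
  Free⇒homCount-injective {m = m} {n = n} {k = k} F H free g inj = begin
    n * homCount F H g
      ≤⟨ *-monoʳ-≤ n (∑ᵛ-mono k collapse) ⟩
    n * ∑ᵛ k (λ s → ∑[ x < m ] ∑[ y < m ] coincide s x y)
      ≡⟨ cong (n *_) (sum-∑ᵛ-comm k λ x s → ∑[ y < m ] coincide s x y) ⟨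
    n * ∑[ x < m ] ∑ᵛ k (λ s → ∑[ y < m ] coincide s x y)
      ≡⟨ cong (n *_) (sum-cong-≗ λ x → sum-∑ᵛ-comm k λ y s → coincide s x y) ⟨
    n * ∑[ x < m ] ∑[ y < m ] ∑ᵛ k (λ s → coincide s x y)
      ≡⟨ *-distribˡ-sum n (λ x → ∑[ y < m ] ∑ᵛ k (λ s → coincide s x y)) ⟩
    ∑[ x < m ] (n * ∑[ y < m ] ∑ᵛ k (λ s → coincide s x y))
      ≡⟨ (sum-cong-≗ λ x → *-distribˡ-sum n (λ y → ∑ᵛ k (λ s → coincide s x y))) ⟩
    ∑[ x < m ] ∑[ y < m ] (n * ∑ᵛ k (λ s → coincide s x y))
      ≤⟨ sum-mono (λ x → sum-mono λ y → few x y) ⟩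
    ∑[ x < m ] ∑[ y < m ] (n ^ k)
      ≡⟨ (trans (sum-cong-≗ {m} λ x → sum-const m (n ^ k)) (sum-const m _)) ⟩
    m * (m * n ^ k)
      ≡⟨ *-assoc m m (n ^ k) ⟨
    m * m * n ^ k ∎
    where
    open ≤-Reasoning
    Coincide : Vec (Fin n) k → Fin m → Fin m → Set
    Coincide s x y = x ≢ y × lookup s (g x) ≡ lookup s (g y)
    Coincide? : ∀ s x y → Dec (Coincide s x y)
    Coincide? s x y = ¬? (x Fin.≟ y) ×-dec (lookup s (g x) Fin.≟ lookup s (g y))
    coincide : Vec (Fin n) k → Fin m → Fin m → ℕ
    coincide s x y = 𝟙 (Coincide? s x y)
    collapse : ∀ s → 𝟙 (Hom? F H (lookup s ∘ g)) ≤ ∑[ x < m ] ∑[ y < m ] coincide s x y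
    collapse s = 𝟙-≤ (Hom? F H (lookup s ∘ g)) λ hom → ≮⇒≥ λ none →
      contradiction (lookup s ∘ g , (λ {x} {y} → injective (λ p → <⇒≱ none p) {x} {y}) , hom) free
      where
      injective : ¬ (1 ≤ ∑[ x < m ] ∑[ y < m ] coincide s x y) → Injective _≡_ _≡_ (lookup s ∘ g)
      injective ¬p {x} {y} eq = decidable-stable (x Fin.≟ y) λ x≢y → ¬p (begin
        1                                       ≡⟨ 𝟙-yes (Coincide? s x y) (x≢y , eq) ⟨
        coincide s x y                          ≤⟨ term≤sum (coincide s x) y ⟩
        ∑[ y < m ] coincide s x y               ≤⟨ term≤sum (λ x → ∑[ y < m ] coincide s x y) x ⟩
        ∑[ x < m ] ∑[ y < m ] coincide s x y    ∎)
    few : ∀ x y → n * ∑ᵛ k (λ s → coincide s x y) ≤ n ^ k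
    few x y = few′ (x Fin.≟ y)
      where
      few′ : Dec (x ≡ y) → n * ∑ᵛ k (λ s → coincide s x y) ≤ n ^ k
      few′ (no x≢y) = ≤-trans
        (*-monoʳ-≤ n (∑ᵛ-mono k λ s → 𝟙-mono (Coincide? s x y) (lookup s (g x) Fin.≟ lookup s (g y)) proj₂))
        (≤-reflexive (∑ᵛ-coincidence k (g x) (g y) (x≢y ∘ inj)))
      few′ (yes x≡y) = subst (_≤ n ^ k) (sym (begin-equality
        n * ∑ᵛ k (λ s → coincide s x y)   ≡⟨ cong (n *_) (∑ᵛ-cong k λ s → 𝟙-no (Coincide? s x y) λ (x≢y , _) → x≢y x≡y) ⟩
        n * ∑ᵛ {n} k (λ _ → 0)            ≡⟨ cong (n *_) (trans (∑ᵛ-const k 0) (*-zeroʳ (n ^ k))) ⟩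
        n * 0                             ≡⟨ *-zeroʳ n ⟩
        0                                 ∎)) z≤n

  -- Splitting every vertex of F turns a dense family of (possibly non-injective)
  -- homomorphisms into one whose underlying map g′ is injective; at density
  -- above m² / n such a family contains an injective homomorphism.
  Free⇒homCount : .{{_ : NonZero n}} → ∀ (F : RGraph r m) (H : RGraph r n) → Free F H →
    ∀ C → iteratedSquare m C * (m * m) ≤ n → ∀ (g : Fin m → Fin k) → C * homCount F H g ≤ n ^ k
  Free⇒homCount {n} {m = m} {k = k} F H free C large g = ≮⇒≥ λ dense →
    let k′ , g′ , dense′ , sep = dense-splits F H (allFin m) g C dense
        injective : Injective _≡_ _≡_ g′
        injective {x} {y} eq = decidable-stable (x Fin.≟ y) λ x≢y → sep {y} (inj₁ (∈-allFin y)) x x≢y eq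
        D = iteratedSquare (length (allFin m)) C
    in <⇒≱ (*-monoʳ-< n dense′) (begin
        n * (D * homCount F H g′)    ≡⟨ exchange n D (homCount F H g′) ⟩
        D * (n * homCount F H g′)    ≤⟨ *-monoʳ-≤ D (Free⇒homCount-injective F H free g′ injective) ⟩
        D * (m * m * n ^ k′)         ≡⟨ *-assoc D (m * m) (n ^ k′) ⟨
        D * (m * m) * n ^ k′         ≡⟨ cong (λ l → iteratedSquare l C * (m * m) * n ^ k′) (length-tabulate {n = m} (λ x → x)) ⟩
        iteratedSquare m C * (m * m) * n ^ k′ ≤⟨ *-monoˡ-≤ (n ^ k′) large ⟩
        n * n ^ k′                   ∎)
    where
    open ≤-Reasoning
    exchange : ∀ x y z → x * (y * z) ≡ y * (x * z)
    exchange = solve-∀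

-- A Chernoff bound in integer arithmetic

module TailBound where

  open import Data.Bool using (if_then_else_)
  open import Data.Fin using (Fin; zero; suc)
  open import Data.Nat
  open import Data.Nat.Properties
  open import Data.Nat.Tactic.RingSolver using (solve-∀)
  open import Data.Vec using (Vec; []; _∷_; lookup)
  open import Relation.Binary.PropositionalEquality
  open import Relation.Nullary using (Dec; does; yes; no)

  open Sums

  private variable
    k n : ℕ

  ^-distribʳ-* : ∀ x y k → (x * y) ^ k ≡ x ^ k * y ^ k
  ^-distribʳ-* x y zero    = refl
  ^-distribʳ-* x y (suc k) = trans (cong (x * y *_) (^-distribʳ-* x y k)) (interchange x y (x ^ k) (y ^ k))
    where
    interchange : ∀ x y u v → x * y * (u * v) ≡ x * u * (y * v)
    interchange = solve-∀

  -- The first two terms of the binomial expansion, kept homogeneous to avoid division.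
  bernoulli : ∀ y z k → y ^ suc k + suc k * z * y ^ k ≤ (y + z) ^ suc k
  bernoulli y z zero    = ≤-reflexive (base y z)
    where
    base : ∀ y z → y * 1 + (z + 0 * z) * 1 ≡ (y + z) * 1
    base = solve-∀
  bernoulli y z (suc k) = begin
    y ^ suc (suc k) + suc (suc k) * z * y ^ suc k
      ≤⟨ m≤m+n _ (suc k * z * z * y ^ k) ⟩
    y ^ suc (suc k) + suc (suc k) * z * y ^ suc k + suc k * z * z * y ^ k
      ≡⟨ factor y z k (y ^ k) ⟩
    (y + z) * (y ^ suc k + suc k * z * y ^ k)
      ≤⟨ *-monoʳ-≤ (y + z) (bernoulli y z k) ⟩
    (y + z) ^ suc (suc k) ∎
    where
    open ≤-Reasoning
    factor : ∀ y z k w → y * (y * w) + suc (suc k) * z * (y * w) + suc k * z * z * w ≡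
                         (y + z) * (y * w + suc k * z * w)
    factor = solve-∀

  -- Bernoulli's inequality `1 - p / b ≤ (1 - 1 / b) ^ p` for `b = suc a`. The induction runs after
  -- adding `p * suc a ^ p` to both sides, so that nothing is subtracted.
  pred-power : ∀ a p t → suc a ≡ p + t → suc a ^ p * t ≤ a ^ p * suc a
  pred-power a p t eq = +-cancelˡ-≤ (p * suc a ^ p) _ _ (begin
    p * suc a ^ p + suc a ^ p * t    ≡⟨ cong (_+ suc a ^ p * t) (*-comm p (suc a ^ p)) ⟩
    suc a ^ p * p + suc a ^ p * t    ≡⟨ *-distribˡ-+ (suc a ^ p) p t ⟨
    suc a ^ p * (p + t)              ≡⟨ cong (suc a ^ p *_) eq ⟨
    suc a ^ p * suc a                ≤⟨ power p ⟩
    p * suc a ^ p + a ^ p * suc a    ∎)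
    where
    open ≤-Reasoning
    expand : ∀ b w → b * w * b ≡ b * (w * b)
    expand = solve-∀
    split : ∀ a x → suc a * x ≡ x + a * x
    split = solve-∀
    rearrange : ∀ a p y w → suc a * y + a * (p * y + w * suc a) + p * y ≡ suc p * (suc a * y) + a * w * suc a
    rearrange = solve-∀
    swap : ∀ b y → y * b ≡ b * y
    swap = solve-∀
    power : ∀ p → suc a ^ p * suc a ≤ p * suc a ^ p + a ^ p * suc a
    power zero    = ≤-refl
    power (suc p) = begin
      suc a * suc a ^ p * suc a
        ≡⟨ trans (expand (suc a) (suc a ^ p)) (split a (suc a ^ p * suc a)) ⟩
      suc a ^ p * suc a + a * (suc a ^ p * suc a)
        ≤⟨ +-mono-≤ (≤-reflexive (swap (suc a) (suc a ^ p))) (*-monoʳ-≤ a (power p)) ⟩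
      suc a * suc a ^ p + a * (p * suc a ^ p + a ^ p * suc a)
        ≤⟨ m≤m+n _ (p * suc a ^ p) ⟩
      suc a * suc a ^ p + a * (p * suc a ^ p + a ^ p * suc a) + p * suc a ^ p
        ≡⟨ rearrange a p (suc a ^ p) (a ^ p) ⟩
      suc p * (suc a * suc a ^ p) + a * a ^ p * suc a ∎

  -- The gain per Q samples: with P = p + 1 and b = a + 1, this is
  -- (1 - P / (Q b)) ^ Q * (1 + 1 / b²) ≤ (1 - 1 / b) ^ p.
  gain : ∀ q p l a u X → p + l ≡ suc q → a ≡ p + u → p * p ≤ u → X + suc p ≡ suc a * suc q →
         X ^ suc q * suc (suc a * suc a) ≤ suc q ^ suc q * (a ^ p * suc a ^ l) * (suc a * suc a)
  gain q p l a u X p+l≡Q a≡p+u p²≤u X+P≡Y = begin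
    X ^ Q * suc (b * b)
      ≤⟨ *-monoʳ-≤ (X ^ Q) b²+1≤ ⟩
    X ^ Q * ((b + suc p) * t)
      ≡⟨ *-assoc (X ^ Q) (b + suc p) t ⟨
    X ^ Q * (b + suc p) * t
      ≤⟨ *-monoˡ-≤ t upper ⟩
    Q ^ Q * b ^ Q * b * t
      ≡⟨ cong (λ e → Q ^ Q * e * b * t) (trans (cong (b ^_) (sym p+l≡Q)) (^-distribˡ-+-* b p l)) ⟩
    Q ^ Q * (b ^ p * b ^ l) * b * t
      ≡⟨ collect (Q ^ Q) (b ^ p) (b ^ l) b t ⟩
    Q ^ Q * b ^ l * b * (b ^ p * t)
      ≤⟨ *-monoʳ-≤ (Q ^ Q * b ^ l * b) (pred-power a p t b≡p+t) ⟩
    Q ^ Q * b ^ l * b * (a ^ p * b)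
      ≡⟨ regroup (Q ^ Q) (b ^ l) b (a ^ p) ⟩
    Q ^ Q * (a ^ p * b ^ l) * (b * b) ∎
    where
    open ≤-Reasoning
    Q = suc q
    b = suc a
    t = suc u
    Y = b * Q
    collect : ∀ x y z b t → x * (y * z) * b * t ≡ x * z * b * (y * t)
    collect = solve-∀
    regroup : ∀ x z b y → x * z * b * (y * b) ≡ x * (y * z) * (b * b)
    regroup = solve-∀
    b≡p+t : b ≡ p + t
    b≡p+t = trans (cong suc a≡p+u) (sym (+-suc p u))
    -- Since `t = suc u = b - p`, the right side exceeds `b * b + 1` by exactly `u - p * p`. The
    -- extra one comes from pairing `suc p` with `p`, the distance between mean and threshold.
    b²+1≤ : suc (b * b) ≤ (b + suc p) * t
    b²+1≤ = subst (λ b → suc (b * b) ≤ (b + suc p) * t) (sym b≡p+t) (begin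
      suc ((p + t) * (p + t))                ≡⟨ expand p u ⟩
      p * p + suc (2 * (p * t) + t * t)      ≤⟨ +-monoˡ-≤ _ p²≤u ⟩
      u + suc (2 * (p * t) + t * t)          ≡⟨ contract p u ⟩
      (p + t + suc p) * t                    ∎)
      where
      expand : ∀ p u → suc ((p + suc u) * (p + suc u)) ≡ p * p + suc (2 * (p * suc u) + suc u * suc u)
      expand = solve-∀
      contract : ∀ p u → u + suc (2 * (p * suc u) + suc u * suc u) ≡ (p + suc u + suc p) * suc u
      contract = solve-∀
    square : X * (Y + suc p) ≤ Y * Y
    square = subst (λ y → X * (y + suc p) ≤ y * y) X+P≡Y
      (≤-trans (m≤m+n _ (suc p * suc p)) (≤-reflexive (complete X (suc p))))
      where
      complete : ∀ x P → x * (x + P + P) + P * P ≡ (x + P) * (x + P)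
      complete = solve-∀
    -- With `P = suc p` this reads `(1 - P / Y) ^ Q * (1 + P / b) ≤ 1`: Bernoulli gives
    -- `1 + P / b ≤ (1 + P / Y) ^ Q`, and `square` gives `(1 - P / Y) * (1 + P / Y) ≤ 1`.
    upper : X ^ Q * (b + suc p) ≤ Q ^ Q * b ^ Q * b
    upper = *-cancelˡ-≤ (Y ^ q * Q) {{m*n≢0 (Y ^ q) Q {{m^n≢0 Y q}}}} (begin
      Y ^ q * Q * (X ^ Q * (b + suc p))          ≡⟨ arrange (Y ^ q) Q (X ^ Q) b (suc p) ⟩
      X ^ Q * (Y * Y ^ q + Q * suc p * Y ^ q)    ≤⟨ *-monoʳ-≤ (X ^ Q) (bernoulli Y (suc p) q) ⟩
      X ^ Q * (Y + suc p) ^ Q                    ≡⟨ ^-distribʳ-* X (Y + suc p) Q ⟨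
      (X * (Y + suc p)) ^ Q                      ≤⟨ ^-monoˡ-≤ Q square ⟩
      (Y * Y) ^ Q                                ≡⟨ ^-distribʳ-* Y Y Q ⟩
      Y ^ Q * Y ^ Q                              ≡⟨ cong (Y ^ Q *_) (^-distribʳ-* b Q Q) ⟩
      Y ^ Q * (b ^ Q * Q ^ Q)                    ≡⟨ final (Y ^ q) b Q (b ^ Q) (Q ^ Q) ⟩
      Y ^ q * Q * (Q ^ Q * b ^ Q * b)            ∎)
      where
      arrange : ∀ y Q x b P → y * Q * (x * (b + P)) ≡ x * (b * Q * y + Q * P * y)
      arrange = solve-∀
      final : ∀ y b Q v w → b * Q * y * (v * w) ≡ y * Q * (w * v * b)
      final = solve-∀

  module _ {P : Fin n → Set} (P? : ∀ v → Dec (P v)) where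

    hits : Vec (Fin n) k → ℕ
    hits {k} s = ∑[ x < k ] 𝟙 (P? (lookup s x))

    module _ (a : ℕ) where

      -- The integer form of the exponential moment `(1 - 1 / b) ^ hits` with `b = suc a`; every
      -- draw is scaled by `b`.
      weight : Fin n → ℕ
      weight v = if does (P? v) then a else suc a

      totalWeight : Vec (Fin n) k → ℕ
      totalWeight []      = 1
      totalWeight (v ∷ s) = weight v * totalWeight s

      sum-weight : sum weight + ∑[ v < n ] 𝟙 (P? v) ≡ n * suc a
      sum-weight = trans (sym (∑-distrib-+ weight (λ v → 𝟙 (P? v))))
        (trans (sum-cong-≗ {n} pointwise) (sum-const n (suc a)))
        where
        pointwise : ∀ v → weight v + 𝟙 (P? v) ≡ suc a
        pointwise v with P? v
        ... | yes _ = +-comm a 1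
        ... | no  _ = +-identityʳ (suc a)

      ∑ᵛ-totalWeight : ∀ k → ∑ᵛ k totalWeight ≡ sum weight ^ k
      ∑ᵛ-totalWeight zero    = refl
      ∑ᵛ-totalWeight (suc k) = begin
        ∑[ v < n ] ∑ᵛ k (λ s → weight v * totalWeight s)
          ≡⟨ (sum-cong-≗ {n} λ v → *-distribˡ-∑ᵛ k (weight v) totalWeight) ⟨
        ∑[ v < n ] (weight v * ∑ᵛ k totalWeight)
          ≡⟨ *-distribʳ-sum (∑ᵛ k totalWeight) weight ⟨
        sum weight * ∑ᵛ k totalWeight
          ≡⟨ cong (sum weight *_) (∑ᵛ-totalWeight k) ⟩
        sum weight ^ suc k ∎
        where open ≡-Reasoning

      totalWeight-hits : ∀ (s : Vec (Fin n) k) → totalWeight s * suc a ^ hits s ≡ a ^ hits s * suc a ^ k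
      totalWeight-hits []      = refl
      totalWeight-hits {suc k} (v ∷ s) with P? v
      ... | yes _ = trans (left a (totalWeight s) (suc a) (suc a ^ hits s))
                    (trans (cong (a * suc a *_) (totalWeight-hits s)) (right a (suc a) (a ^ hits s) (suc a ^ k)))
        where
        left : ∀ a w b x → a * w * (b * x) ≡ a * b * (w * x)
        left = solve-∀
        right : ∀ a b y z → a * b * (y * z) ≡ a * y * (b * z)
        right = solve-∀
      ... | no  _ = trans (*-assoc (suc a) (totalWeight s) _)
                    (trans (cong (suc a *_) (totalWeight-hits s)) (exchange (suc a) (a ^ hits s) (suc a ^ k)))
        where
        exchange : ∀ x y z → x * (y * z) ≡ y * (x * z)
        exchange = solve-∀

      few-hits⇒heavy : ∀ {j l} → j + l ≡ k → (s : Vec (Fin n) k) → hits s ≤ j → a ^ j * suc a ^ l ≤ totalWeight s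
      few-hits⇒heavy {k} {j} {l} j+l≡k s h≤j = *-cancelʳ-≤ _ _ (suc a ^ h) {{m^n≢0 (suc a) h}} (begin
        a ^ j * b ^ l * b ^ h                    ≡⟨ cong (λ x → a ^ x * b ^ l * b ^ h) (m+[n∸m]≡n h≤j) ⟨
        a ^ (h + d) * b ^ l * b ^ h              ≡⟨ cong (λ x → x * b ^ l * b ^ h) (^-distribˡ-+-* a h d) ⟩
        a ^ h * a ^ d * b ^ l * b ^ h            ≤⟨ *-monoˡ-≤ (b ^ h) (*-monoˡ-≤ (b ^ l) (*-monoʳ-≤ (a ^ h) (^-monoˡ-≤ d (n≤1+n a)))) ⟩
        a ^ h * b ^ d * b ^ l * b ^ h            ≡⟨ rearrange (a ^ h) (b ^ d) (b ^ l) (b ^ h) ⟩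
        a ^ h * (b ^ h * b ^ d * b ^ l)          ≡⟨ cong (λ x → a ^ h * (x * b ^ l)) (^-distribˡ-+-* b h d) ⟨
        a ^ h * (b ^ (h + d) * b ^ l)            ≡⟨ cong (λ x → a ^ h * (b ^ x * b ^ l)) (m+[n∸m]≡n h≤j) ⟩
        a ^ h * (b ^ j * b ^ l)                  ≡⟨ cong (a ^ h *_) (^-distribˡ-+-* b j l) ⟨
        a ^ h * b ^ (j + l)                      ≡⟨ cong (λ x → a ^ h * b ^ x) j+l≡k ⟩
        a ^ h * b ^ k                            ≡⟨ totalWeight-hits s ⟨
        totalWeight s * b ^ h                    ∎)
        where
        open ≤-Reasoning
        b = suc a
        h = hits s
        d = j ∸ h
        rearrange : ∀ x y z w → x * y * z * w ≡ x * (w * y * z)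
        rearrange = solve-∀

      -- Tuples with few hits are heavy, while independence of the draws makes the total weight a
      -- `k`-th power.
      markov : ∀ {k j l} → j + l ≡ k → ∑ᵛ k (λ s → 𝟙 (hits s <? j)) * (a ^ j * suc a ^ l) ≤ sum weight ^ k
      markov {k} {j} {l} j+l≡k = begin
        ∑ᵛ k (λ s → 𝟙 (hits s <? j)) * c          ≡⟨ *-comm _ c ⟩
        c * ∑ᵛ k (λ s → 𝟙 (hits s <? j))          ≡⟨ *-distribˡ-∑ᵛ k c _ ⟩
        ∑ᵛ k (λ s → c * 𝟙 (hits s <? j))          ≤⟨ ∑ᵛ-mono k heavy ⟩
        ∑ᵛ k totalWeight                          ≡⟨ ∑ᵛ-totalWeight k ⟩
        sum weight ^ k                            ∎
        where
        open ≤-Reasoning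
        c = a ^ j * suc a ^ l
        heavy : ∀ s → c * 𝟙 (hits s <? j) ≤ totalWeight s
        heavy s = *-𝟙-≤ c (hits s <? j) λ h<j → few-hits⇒heavy j+l≡k s (<⇒≤ h<j)

    -- The draws form `K` blocks of `Q`, and `gain` saves a factor `B / suc B` on each. The
    -- threshold `p * K` lies at least `K` below the expected number of hits.
    tail-bound : ∀ q p K → p ≤ q → let Q = suc q ; B = suc (Q * Q) * suc (Q * Q) in
      suc p * n ≤ Q * ∑[ v < n ] 𝟙 (P? v) →
      ∑ᵛ (Q * K) (λ s → 𝟙 (hits s <? p * K)) * suc B ^ K ≤ B ^ K * n ^ (Q * K)
    tail-bound q p K p≤q dense = *-cancelˡ-≤ (N ^ K) {{m^n≢0 N K {{N≢0}}}} (begin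
      N ^ K * (fails * suc B ^ K)
        ≡⟨ cong (_* (fails * suc B ^ K)) (^-distribʳ-* (Q ^ Q) (a ^ p * b ^ l) K) ⟩
      (Q ^ Q) ^ K * (a ^ p * b ^ l) ^ K * (fails * suc B ^ K)
        ≡⟨ rearrange ((Q ^ Q) ^ K) ((a ^ p * b ^ l) ^ K) fails (suc B ^ K) ⟩
      (Q ^ Q) ^ K * (fails * (a ^ p * b ^ l) ^ K) * suc B ^ K
        ≤⟨ *-monoˡ-≤ (suc B ^ K) (*-monoʳ-≤ ((Q ^ Q) ^ K) moment) ⟩
      (Q ^ Q) ^ K * W ^ (Q * K) * suc B ^ K
        ≡⟨ cong (λ x → x * W ^ (Q * K) * suc B ^ K) (^-*-assoc Q Q K) ⟩
      Q ^ (Q * K) * W ^ (Q * K) * suc B ^ K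
        ≡⟨ cong (_* suc B ^ K) (^-distribʳ-* Q W (Q * K)) ⟨
      (Q * W) ^ (Q * K) * suc B ^ K
        ≤⟨ *-monoˡ-≤ (suc B ^ K) (^-monoˡ-≤ (Q * K) QW≤Xn) ⟩
      (X * n) ^ (Q * K) * suc B ^ K
        ≡⟨ cong (_* suc B ^ K) (^-distribʳ-* X n (Q * K)) ⟩
      X ^ (Q * K) * n ^ (Q * K) * suc B ^ K
        ≡⟨ cong (λ x → x * n ^ (Q * K) * suc B ^ K) (^-*-assoc X Q K) ⟨
      (X ^ Q) ^ K * n ^ (Q * K) * suc B ^ K
        ≡⟨ swap₃ ((X ^ Q) ^ K) (n ^ (Q * K)) (suc B ^ K) ⟩
      (X ^ Q) ^ K * suc B ^ K * n ^ (Q * K)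
        ≡⟨ cong (_* n ^ (Q * K)) (^-distribʳ-* (X ^ Q) (suc B) K) ⟨
      (X ^ Q * suc B) ^ K * n ^ (Q * K)
        ≤⟨ *-monoˡ-≤ (n ^ (Q * K)) (^-monoˡ-≤ K (gain q p l a u X p+l≡Q (sym p+u≡a) p²≤u X+P≡Y)) ⟩
      (N * B) ^ K * n ^ (Q * K)
        ≡⟨ cong (_* n ^ (Q * K)) (^-distribʳ-* N B K) ⟩
      N ^ K * B ^ K * n ^ (Q * K)
        ≡⟨ *-assoc (N ^ K) (B ^ K) _ ⟩
      N ^ K * (B ^ K * n ^ (Q * K)) ∎)
      where
      open ≤-Reasoning
      Q = suc q
      -- Large enough for `p * p + p ≤ a`, as `gain` demands.
      a = Q * Q
      b = suc a
      B = b * b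
      l = Q ∸ p
      u = a ∸ p
      X = b * Q ∸ suc p
      -- The threshold weight of a block, with `p` hits and `l` misses, times `Q ^ Q` to clear the
      -- denominator of the mean weight.
      N = Q ^ Q * (a ^ p * b ^ l)
      W = sum (weight a)
      fails = ∑ᵛ (Q * K) (λ s → 𝟙 (hits s <? p * K))
      N≢0 : NonZero N
      N≢0 = m*n≢0 (Q ^ Q) (a ^ p * b ^ l) {{m^n≢0 Q Q}} {{m*n≢0 (a ^ p) (b ^ l) {{m^n≢0 a p}} {{m^n≢0 b l}}}}
      p+l≡Q : p + l ≡ Q
      p+l≡Q = m+[n∸m]≡n (m≤n⇒m≤1+n p≤q)
      p²+p≤a : p * p + p ≤ a
      p²+p≤a = ≤-trans (≤-reflexive (+-comm (p * p) p)) (*-mono-≤ {suc p} {Q} {p} {Q} (s≤s p≤q) (m≤n⇒m≤1+n p≤q))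
      p+u≡a : p + u ≡ a
      p+u≡a = m+[n∸m]≡n (≤-trans (m≤n+m p (p * p)) p²+p≤a)
      p²≤u : p * p ≤ u
      p²≤u = m+n≤o⇒m≤o∸n (p * p) p²+p≤a
      X+P≡Y : X + suc p ≡ b * Q
      X+P≡Y = m∸n+n≡m (≤-trans (s≤s p≤q) (m≤m+n Q (a * Q)))
      -- The mean weight of a vertex is at most `b - suc p / Q`, which is `X / Q`.
      QW≤Xn : Q * W ≤ X * n
      QW≤Xn = +-cancelʳ-≤ (suc p * n) _ _ (begin
        Q * W + suc p * n                               ≤⟨ +-monoʳ-≤ (Q * W) dense ⟩
        Q * W + Q * ∑[ v < n ] 𝟙 (P? v)                 ≡⟨ *-distribˡ-+ Q W _ ⟨
        Q * (W + ∑[ v < n ] 𝟙 (P? v))                   ≡⟨ cong (Q *_) (sum-weight a) ⟩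
        Q * (n * b)                                     ≡⟨ reorder Q n b ⟩
        b * Q * n                                       ≡⟨ cong (_* n) X+P≡Y ⟨
        (X + suc p) * n                                 ≡⟨ *-distribʳ-+ n X (suc p) ⟩
        X * n + suc p * n                               ∎)
        where
        reorder : ∀ Q n b → Q * (n * b) ≡ b * Q * n
        reorder = solve-∀
      moment : fails * (a ^ p * b ^ l) ^ K ≤ W ^ (Q * K)
      moment = subst (λ x → fails * x ≤ W ^ (Q * K))
        (sym (trans (^-distribʳ-* (a ^ p) (b ^ l) K) (cong₂ _*_ (^-*-assoc a p K) (^-*-assoc b l K))))
        (markov a {Q * K} {p * K} {l * K} (trans (sym (*-distribʳ-+ K p l)) (cong (_* K) p+l≡Q)))
      rearrange : ∀ x y z w → x * y * (z * w) ≡ x * (z * y) * w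
      rearrange = solve-∀
      swap₃ : ∀ x y z → x * y * z ≡ x * z * y
      swap₃ = solve-∀

-- Random samples of an `F`-free hypergraph

module Sampling where

  open import Data.Fin using (Fin; zero; suc; fromℕ<)
  open import Data.Fin.Subset using (Subset; inside; outside; _∈_; _∉_; _⊆_; ∣_∣; ⊤)
  open import Data.Fin.Subset.Properties using (_∈?_; ∣⊤∣≡n)
  open import Data.Nat
  open import Data.Nat.Properties
  open import Data.Nat.Tactic.RingSolver using (solve-∀)
  open import Data.Product using (∃-syntax; Σ-syntax; _×_; _,_; proj₁; proj₂)
  open import Data.Vec using (Vec; []; _∷_; lookup; tabulate; here; there; _[_]≔_)
  open import Data.Vec.Properties using (lookup∘update; lookup∘update′; lookup∘tabulate)
  open import Function using (_∘_)
  open import Relation.Binary.PropositionalEquality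
  open import Relation.Nullary using (¬_; Dec; yes; no; _×-dec_)

  open import Defs hiding (_+_; _-_; -_; _<_)
  open Sums
  open Subsets
  open Hypergraphs
  open HomCount
  open TailBound

  private variable
    r k m n : ℕ

  -- Starting from one good tuple, redraw the coordinates in turn: at those in `U` at least `n / c`
  -- values keep the property, elsewhere all do. The hypotheses speak of every good tuple so that
  -- they remain available after each change.
  exchangeable⇒dense : ∀ (U : Subset k) {P : Vec (Fin n) k → Set} (P? : ∀ s → Dec (P s)) c →
    (∀ s → P s → ∀ {i} → i ∈ U → n ≤ c * ∑[ z < n ] 𝟙 (P? (s [ i ]≔ z))) →
    (∀ s → P s → ∀ {i} → i ∉ U → ∀ z → P (s [ i ]≔ z)) →
    ∃[ s ] P s → n ^ k ≤ c ^ ∣ U ∣ * ∑ᵛ k (λ s → 𝟙 (P? s))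
  exchangeable⇒dense [] P? c inn out ([] , p) =
    ≤-reflexive (trans (sym (𝟙-yes (P? []) p)) (sym (*-identityˡ _)))
  exchangeable⇒dense {suc k} {n} (side ∷ U) {P} P? c inn out (x ∷ s , p) = go side inn out
    where
    open ≤-Reasoning
    tail-dense : ∀ side →
      (∀ s → P s → ∀ {i} → i ∈ side ∷ U → n ≤ c * ∑[ z < n ] 𝟙 (P? (s [ i ]≔ z))) →
      (∀ s → P s → ∀ {i} → i ∉ side ∷ U → ∀ z → P (s [ i ]≔ z)) →
      ∀ y → P (y ∷ s) → n ^ k ≤ c ^ ∣ U ∣ * ∑ᵛ k (λ s → 𝟙 (P? (y ∷ s)))
    tail-dense side inn out y p = exchangeable⇒dense U (λ s → P? (y ∷ s)) c
      (λ s p {i} i∈ → inn (y ∷ s) p {suc i} (there i∈))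
      (λ s p {i} i∉ → out (y ∷ s) p {suc i} λ { (there i∈) → i∉ i∈ }) (s , p)
    go : ∀ side →
      (∀ s → P s → ∀ {i} → i ∈ side ∷ U → n ≤ c * ∑[ z < n ] 𝟙 (P? (s [ i ]≔ z))) →
      (∀ s → P s → ∀ {i} → i ∉ side ∷ U → ∀ z → P (s [ i ]≔ z)) →
      n ^ suc k ≤ c ^ ∣ side ∷ U ∣ * ∑ᵛ (suc k) (λ s → 𝟙 (P? s))
    go inside inn out = begin
      n * n ^ k
        ≤⟨ *-monoˡ-≤ (n ^ k) (inn (x ∷ s) p here) ⟩
      c * ∑[ z < n ] 𝟙 (P? (z ∷ s)) * n ^ k
        ≡⟨ *-assoc c _ (n ^ k) ⟩
      c * (∑[ z < n ] 𝟙 (P? (z ∷ s)) * n ^ k)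
        ≡⟨ cong (c *_) (*-distribʳ-sum (n ^ k) (λ z → 𝟙 (P? (z ∷ s)))) ⟩
      c * ∑[ z < n ] (𝟙 (P? (z ∷ s)) * n ^ k)
        ≤⟨ *-monoʳ-≤ c (sum-mono λ z → ≤-trans (≤-reflexive (*-comm (𝟙 (P? (z ∷ s))) (n ^ k)))
             (*-𝟙-≤ (n ^ k) (P? (z ∷ s)) (tail-dense inside inn out z))) ⟩
      c * ∑[ z < n ] (c ^ ∣ U ∣ * ∑ᵛ k (λ s → 𝟙 (P? (z ∷ s))))
        ≡⟨ cong (c *_) (*-distribˡ-sum (c ^ ∣ U ∣) (λ z → ∑ᵛ k (λ s → 𝟙 (P? (z ∷ s))))) ⟨
      c * (c ^ ∣ U ∣ * ∑ᵛ (suc k) (λ s → 𝟙 (P? s)))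
        ≡⟨ *-assoc c (c ^ ∣ U ∣) _ ⟨
      c * c ^ ∣ U ∣ * ∑ᵛ (suc k) (λ s → 𝟙 (P? s)) ∎
    go outside inn out = begin
      n * n ^ k
        ≡⟨ sum-const n (n ^ k) ⟨
      ∑[ z < n ] (n ^ k)
        ≤⟨ sum-mono {n} (λ z → tail-dense outside inn out z (out (x ∷ s) p {zero} (λ ()) z)) ⟩
      ∑[ z < n ] (c ^ ∣ U ∣ * ∑ᵛ k (λ s → 𝟙 (P? (z ∷ s))))
        ≡⟨ *-distribˡ-sum (c ^ ∣ U ∣) (λ z → ∑ᵛ k (λ s → 𝟙 (P? (z ∷ s)))) ⟨
      c ^ ∣ U ∣ * ∑ᵛ (suc k) (λ s → 𝟙 (P? s)) ∎

  module _ (H : RGraph (suc r) n) where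

    -- Dropping one position of `U` from an edge leaves a positive set, which at least `n / c`
    -- vertices complete to an edge. So that position can be redrawn at a cost of a factor `c`.
    edges-dense : ∀ c → n ≤ c * δ⁺ H → ∃[ e ] Edge H e → ∀ (U : Subset k) → ∣ U ∣ ≡ suc r → Fin n →
                  n ^ k ≤ c ^ suc r * ∑ᵛ k (λ s → 𝟙 (Edge? H (image (lookup s) U)))
    edges-dense {k} c dense (e , p) U ∣U∣ z₀ = subst (λ j → n ^ k ≤ c ^ j * ∑ᵛ k (λ s → 𝟙 (P? s))) ∣U∣
      (exchangeable⇒dense U P? c inn out (s₀ , subst (Edge H) (sym image-s₀) p))
      where
      P? : ∀ s → Dec (Edge H (image (lookup s) U))
      P? s = Edge? H (image (lookup s) U)
      start = equinumerous⇒image U e (trans ∣U∣ (sym (uniform H e p))) z₀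
      s₀ = proj₁ start
      image-s₀ = proj₂ start
      out : ∀ s → Edge H (image (lookup s) U) → ∀ {i} → i ∉ U → ∀ z → Edge H (image (lookup (s [ i ]≔ z)) U)
      out s p {i} i∉U z = subst (Edge H)
        (image-local U λ {j} j∈U → sym (lookup∘update′ (λ { refl → i∉U j∈U }) s z)) p
      inn : ∀ s → Edge H (image (lookup s) U) → ∀ {i} → i ∈ U →
            n ≤ c * ∑[ z < n ] 𝟙 (Edge? H (image (lookup (s [ i ]≔ z)) U))
      inn s p {i} i∈U = begin
        n                                                  ≤⟨ dense ⟩
        c * δ⁺ H                                           ≤⟨ *-monoʳ-≤ c (δ⁺-bound H S positive) ⟩
        c * codegree H S                                   ≡⟨ cong (c *_) (codegree≡ H S (proj₁ positive)) ⟩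
        c * ∑[ z < n ] 𝟙 (Edge? H (insert z S))            ≡⟨ cong (c *_) (sum-cong-≗ {n} λ z → cong (λ X → 𝟙 (Edge? H X)) (image-update z)) ⟨
        c * ∑[ z < n ] 𝟙 (Edge? H (image (lookup (s [ i ]≔ z)) U)) ∎
        where
        open ≤-Reasoning
        U⁻ = remove i U
        S = image (lookup s) U⁻
        U⁻⊆U : U⁻ ⊆ U
        U⁻⊆U {j} j∈ = subst (j ∈_) (insert-remove i∈U) (∈-insert⁺ i U⁻ j∈)
        positive : Positive H S
        positive =
          trans (injectiveOn⇒∣image∣≡ (lookup s) U⁻ λ a b →
                   ∣image∣≡⇒injectiveOn (lookup s) U (trans (uniform H _ p) (sym ∣U∣)) (U⁻⊆U a) (U⁻⊆U b))
                (suc-injective (trans (sym (∣remove∣ i∈U)) ∣U∣)) ,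
          image (lookup s) U , p ,
          λ q → let j , j∈ , eq = ∈-image⁻ (lookup s) q in
                subst (_∈ image (lookup s) U) eq (∈-image⁺ (lookup s) (U⁻⊆U j∈))
        image-update : ∀ z → image (lookup (s [ i ]≔ z)) U ≡ insert z S
        image-update z = trans (cong (image (lookup (s [ i ]≔ z))) (sym (insert-remove i∈U)))
          (trans (image-insert (lookup (s [ i ]≔ z)) i U⁻)
          (cong₂ insert (lookup∘update i s z)
            (image-local U⁻ λ {j} j∈ → lookup∘update′ (λ { refl → ∉-remove i U j∈ }) s z)))

    -- The summand `r` compensates for the positions of `S` itself, whose redrawn values may be hits
    -- but are discarded by `merge`.
    Deficient : ℕ → Subset k → Vec (Fin n) k → Set
    Deficient j S s = Positive (blowup H (lookup s)) S × codegree (blowup H (lookup s)) S + r < j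

    Deficient? : ∀ j (S : Subset k) s → Dec (Deficient j S s)
    Deficient? j S s = Positive? (blowup H (lookup s)) S ×-dec (codegree (blowup H (lookup s)) S + r <? j)

    -- Outside `S` the merged sample agrees with `t`, and the `r` positions of `S` account for at
    -- most `r` hits.
    hits-merge : ∀ (S : Subset k) s t → Positive (blowup H (lookup (merge S s t))) S →
      hits (λ v → Edge? H (insert v (image (lookup s) S))) t ≤ codegree (blowup H (lookup (merge S s t))) S + r
    hits-merge {k} S s t pos = begin
      ∑[ x < k ] 𝟙 (P? (lookup t x))
        ≤⟨ sum-mono pointwise ⟩
      ∑[ x < k ] (𝟙 (P? (lookup u x)) + 𝟙 (x ∈? S))
        ≡⟨ ∑-distrib-+ (λ x → 𝟙 (P? (lookup u x))) (λ x → 𝟙 (x ∈? S)) ⟩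
      ∑[ x < k ] 𝟙 (P? (lookup u x)) + ∑[ x < k ] 𝟙 (x ∈? S)
        ≡⟨ cong₂ _+_ (sum-cong-≗ {k} λ x → cong (λ X → 𝟙 (Edge? H (insert (lookup u x) X)))
             (sym (image-local S (lookup-merge-∈ s t))))
             (trans (sym (∣S∣≡∑𝟙 S)) (proj₁ pos)) ⟩
      ∑[ x < k ] 𝟙 (Edge? H (insert (lookup u x) (image (lookup u) S))) + r
        ≤⟨ +-monoˡ-≤ r (blowup-codegree H (lookup u) S pos) ⟩
      codegree (blowup H (lookup u)) S + r ∎
      where
      open ≤-Reasoning
      u = merge S s t
      P? = λ v → Edge? H (insert v (image (lookup s) S))
      pointwise : ∀ x → 𝟙 (P? (lookup t x)) ≤ 𝟙 (P? (lookup u x)) + 𝟙 (x ∈? S)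
      pointwise x = by (x ∈? S)
        where
        by : (d : Dec (x ∈ S)) → 𝟙 (P? (lookup t x)) ≤ 𝟙 (P? (lookup u x)) + 𝟙 d
        by (yes _)  = ≤-trans (𝟙≤1 (P? (lookup t x))) (m≤n+m 1 _)
        by (no x∉S) = subst (λ v → 𝟙 (P? (lookup t x)) ≤ 𝟙 (P? v) + 0) (sym (lookup-merge-∉ s t x∉S))
                        (m≤m+n _ 0)

    -- Resampling the coordinates outside S makes the neighbourhood of the image
    -- of S independent of the sample that has to hit it.
    deficient-rare : .{{_ : NonZero n}} → ∀ q p K → p ≤ q → let Q = suc q ; B = suc (Q * Q) * suc (Q * Q) in
      suc p * n ≤ Q * δ⁺ H → ∀ (S : Subset (Q * K)) →
      ∑ᵛ (Q * K) (λ s → 𝟙 (Deficient? (p * K) S s)) * suc B ^ K ≤ B ^ K * n ^ (Q * K)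
    deficient-rare q p K p≤q dense S = *-cancelˡ-≤ (n ^ M) {{m^n≢0 n M}} (begin
      n ^ M * (∑ᵛ M f * suc B ^ K)
        ≡⟨ *-assoc (n ^ M) (∑ᵛ M f) _ ⟨
      n ^ M * ∑ᵛ M f * suc B ^ K
        ≡⟨ cong (_* suc B ^ K) (∑ᵛ-merge M f S) ⟩
      ∑ᵛ M (λ s → ∑ᵛ M λ t → f (merge S s t)) * suc B ^ K
        ≡⟨ trans (*-comm _ (suc B ^ K)) (*-distribˡ-∑ᵛ M (suc B ^ K) _) ⟩
      ∑ᵛ M (λ s → suc B ^ K * ∑ᵛ M λ t → f (merge S s t))
        ≤⟨ ∑ᵛ-mono M (λ s → ≤-trans (≤-reflexive (*-comm (suc B ^ K) _)) (fixed s (Positive? H (image (lookup s) S)))) ⟩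
      ∑ᵛ {n} M (λ s → B ^ K * n ^ M)
        ≡⟨ ∑ᵛ-const M _ ⟩
      n ^ M * (B ^ K * n ^ M) ∎)
      where
      open ≤-Reasoning
      Q = suc q
      M = Q * K
      B = suc (Q * Q) * suc (Q * Q)
      f : Vec (Fin n) M → ℕ
      f s = 𝟙 (Deficient? (p * K) S s)
      image-merge : ∀ s t → image (lookup (merge S s t)) S ≡ image (lookup s) S
      image-merge s t = image-local S (lookup-merge-∈ s t)
      fixed : ∀ s → Dec (Positive H (image (lookup s) S)) →
              ∑ᵛ M (λ t → f (merge S s t)) * suc B ^ K ≤ B ^ K * n ^ M
      -- The image of `S` does not depend on `t`; unless it is positive in `H`, no merged sample
      -- makes `S` positive.
      fixed s (no ¬pos) = subst (λ x → x * suc B ^ K ≤ B ^ K * n ^ M) (sym (begin-equality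
        ∑ᵛ M (λ t → f (merge S s t))   ≡⟨ (∑ᵛ-cong M λ t → 𝟙-no (Deficient? (p * K) S (merge S s t)) λ (pos , _) →
                                             ¬pos (subst (Positive H) (image-merge s t) (blowup-Positive H _ S pos))) ⟩
        ∑ᵛ {n} M (λ _ → 0)             ≡⟨ ∑ᵛ-const M 0 ⟩
        n ^ M * 0                      ≡⟨ *-zeroʳ (n ^ M) ⟩
        0                              ∎)) z≤n
      fixed s (yes pos) = begin
        ∑ᵛ M (λ t → f (merge S s t)) * suc B ^ K
          ≤⟨ *-monoˡ-≤ (suc B ^ K) (∑ᵛ-mono M λ t → 𝟙-mono (Deficient? (p * K) S (merge S s t)) (hits P? t <? p * K)
               λ (pos , few) → ≤-<-trans (hits-merge S s t pos) few) ⟩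
        ∑ᵛ M (λ t → 𝟙 (hits P? t <? p * K)) * suc B ^ K
          ≤⟨ tail-bound P? q p K p≤q (≤-trans dense (*-monoʳ-≤ Q (≤-trans (δ⁺-bound H S′ pos)
               (≤-reflexive (codegree≡ H S′ (proj₁ pos)))))) ⟩
        B ^ K * n ^ M ∎
        where
        S′ = image (lookup s) S
        P? = λ v → Edge? H (insert v S′)

  -- Edges occur in at least `3 / A` of the samples, while the counts of deficient sets and of
  -- homomorphisms each average at most `1 / A`. Hence some sample has `bad s < edges s`; as
  -- `edges s` is at most one, nothing bad happens there and `U` is an edge.
  ∃-good-sample : .{{_ : NonZero n}} → ∀ (F : RGraph (suc r) m) (H : RGraph (suc r) n) → Free F H →
    ∀ M .{{_ : NonZero M}} (U : Subset M) → ∣ U ∣ ≡ suc r → ∀ j A D E .{{_ : NonZero E}} →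
    3 * n ^ M ≤ A * ∑ᵛ M (λ s → 𝟙 (Edge? H (image (lookup s) U))) →
    (∀ S → ∑ᵛ M (λ s → 𝟙 (Deficient? H j S s)) * E ≤ D * n ^ M) → A * M ^ r * D ≤ E →
    iteratedSquare m (A * M ^ m) * (m * m) ≤ n →
    Σ[ H′ ∈ RGraph (suc r) M ] (HomFree F H′ × j ≤ r + δ⁺ H′)
  ∃-good-sample {n} {r} {m} F H free M U ∣U∣ j A D E many-edges rare D≪E large =
    blowup H (lookup s) , homFree , δ-bound
    where
    open ≤-Reasoning
    -- Tuples replace `r`-subsets of positions: each such set is the image of some tuple, and the
    -- number of tuples is a plain power.
    deficient : Vec (Fin M) r → Vec (Fin n) M → ℕ
    deficient σ s = 𝟙 (Deficient? H j (image (lookup σ) ⊤) s)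
    mapped : Vec (Fin M) m → Vec (Fin n) M → ℕ
    mapped g s = 𝟙 (Hom? F H (lookup s ∘ lookup g))
    edges : Vec (Fin n) M → ℕ
    edges s = 𝟙 (Edge? H (image (lookup s) U))
    bad : Vec (Fin n) M → ℕ
    bad s = ∑ᵛ r (λ σ → deficient σ s) + ∑ᵛ m (λ g → mapped g s)
    few-deficient : A * ∑ᵛ r (λ σ → ∑ᵛ M (deficient σ)) ≤ n ^ M
    few-deficient = ∑ᵛ-≤-average r A (n ^ M) (λ σ → ∑ᵛ M (deficient σ)) {{m^n≢0 M r}} λ σ →
      *-cancelʳ-≤ (A * M ^ r * ∑ᵛ M (deficient σ)) (n ^ M) E (begin
        A * M ^ r * ∑ᵛ M (deficient σ) * E       ≡⟨ *-assoc (A * M ^ r) _ E ⟩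
        A * M ^ r * (∑ᵛ M (deficient σ) * E)     ≤⟨ *-monoʳ-≤ (A * M ^ r) (rare (image (lookup σ) ⊤)) ⟩
        A * M ^ r * (D * n ^ M)                  ≡⟨ *-assoc (A * M ^ r) D (n ^ M) ⟨
        A * M ^ r * D * n ^ M                    ≤⟨ *-monoˡ-≤ (n ^ M) D≪E ⟩
        E * n ^ M                                ≡⟨ *-comm E (n ^ M) ⟩
        n ^ M * E                                ∎)
    few-mapped : A * ∑ᵛ m (λ g → ∑ᵛ M (mapped g)) ≤ n ^ M
    few-mapped = ∑ᵛ-≤-average m A (n ^ M) (λ g → ∑ᵛ M (mapped g)) {{m^n≢0 M m}} λ g →
      Free⇒homCount F H free (A * M ^ m) large (lookup g)
    good : ∃[ s ] bad s < edges s
    good = ∑ᵛ-<⇒∃< M bad edges (*-cancelˡ-< A _ _ (begin-strict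
      A * ∑ᵛ M bad
        ≡⟨ cong (A *_) (∑ᵛ-distrib-+ M (λ s → ∑ᵛ r λ σ → deficient σ s) (λ s → ∑ᵛ m λ g → mapped g s)) ⟩
      A * (∑ᵛ M (λ s → ∑ᵛ r λ σ → deficient σ s) + ∑ᵛ M (λ s → ∑ᵛ m λ g → mapped g s))
        ≡⟨ cong (A *_) (cong₂ _+_ (∑ᵛ-comm r M deficient) (∑ᵛ-comm m M mapped)) ⟨
      A * (∑ᵛ r (λ σ → ∑ᵛ M (deficient σ)) + ∑ᵛ m (λ g → ∑ᵛ M (mapped g)))
        ≡⟨ *-distribˡ-+ A (∑ᵛ r λ σ → ∑ᵛ M (deficient σ)) _ ⟩
      A * ∑ᵛ r (λ σ → ∑ᵛ M (deficient σ)) + A * ∑ᵛ m (λ g → ∑ᵛ M (mapped g))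
        ≤⟨ +-mono-≤ few-deficient few-mapped ⟩
      n ^ M + n ^ M
        <⟨ m<n+m _ (m^n>0 n M) ⟩
      n ^ M + (n ^ M + n ^ M)
        ≡⟨ triple (n ^ M) ⟩
      3 * n ^ M
        ≤⟨ many-edges ⟩
      A * ∑ᵛ M edges ∎))
      where
      triple : ∀ x → x + (x + x) ≡ 3 * x
      triple = solve-∀
    s : Vec (Fin n) M
    s = proj₁ good
    U-edge : Edge (blowup H (lookup s)) U
    U-edge = blowup-edge⁺ H (lookup s) U ∣U∣
      (0<𝟙⇒ (Edge? H (image (lookup s) U)) (≤-<-trans z≤n (proj₂ good)))
    bad≡0 : bad s ≡ 0
    bad≡0 = n<1⇒n≡0 (<-≤-trans (proj₂ good) (𝟙≤1 (Edge? H (image (lookup s) U))))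
    homFree : HomFree F (blowup H (lookup s))
    homFree f hom = 𝟙≡0⇒¬ (Hom? F H (lookup s ∘ lookup g))
      (n≤0⇒n≡0 (≤-trans (term≤∑ᵛ m (λ g → mapped g s) g) (≤-trans (m≤n+m _ _) (≤-reflexive bad≡0))))
      λ e p → subst (Edge H)
        (trans (image-∘ (lookup s) f e) (image-cong (λ x → cong (lookup s) (sym (lookup∘tabulate f x))) e))
        (blowup-edge⁻ H (lookup s) _ (hom e p))
      where
      g = tabulate f
    not-deficient : ∀ σ → ¬ Deficient H j (image (lookup σ) ⊤) s
    not-deficient σ = 𝟙≡0⇒¬ (Deficient? H j (image (lookup σ) ⊤) s)
      (n≤0⇒n≡0 (≤-trans (term≤∑ᵛ r (λ σ → deficient σ s) σ) (≤-trans (m≤m+n _ _) (≤-reflexive bad≡0))))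
    δ-bound : j ≤ r + δ⁺ (blowup H (lookup s))
    δ-bound = ≤-trans (m≤n+m∸n j r) (+-monoʳ-≤ r (δ⁺-greatest (blowup H (lookup s)) (U , U-edge) (j ∸ r) bound))
      where
      bound : ∀ S → Positive (blowup H (lookup s)) S → j ∸ r ≤ codegree (blowup H (lookup s)) S
      bound S pos = m≤n+o⇒m∸n≤o j r (≤-trans
        (≮⇒≥ λ few → subst (λ S → ¬ Deficient H j S s) (proj₂ preimage) (not-deficient (proj₁ preimage)) (pos , few))
        (≤-reflexive (+-comm _ r)))
        where
        preimage : ∃[ σ ] image (lookup σ) ⊤ ≡ S
        preimage = equinumerous⇒image (⊤ {r}) S (trans (∣⊤∣≡n r) (sym (proj₁ pos))) (fromℕ< (>-nonZero⁻¹ M))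

-- Approximating the extremal ratio by one finite hypergraph

module Approximation where

  open import Data.Bool using (T)
  open import Data.Fin using (Fin; zero; suc)
  open import Data.List using (filter)
  open import Data.List.Extrema.Nat using (argmax; argmax-all; f[xs]≤f[argmax])
  open import Data.List.Membership.Propositional.Properties using (∈-filter⁺; ∈-filter⁻)
  import Data.List.Relation.Unary.All as All
  open import Data.Nat
  open import Data.Nat.DivMod using (m/n*n≤m; m≡m%n+[m/n]*n; m%n<n)
  open import Data.Nat.Properties
  open import Data.Nat.Tactic.RingSolver using (solve-∀)
  open import Data.Product using (∃-syntax; Σ-syntax; _×_; _,_; proj₁; proj₂)
  open import Data.Vec using (lookup)
  open import Relation.Binary.PropositionalEquality
  open import Relation.Nullary using (Dec; yes; no; contradiction)

  open import Defs hiding (_+_; _-_; -_; _<_)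
  open Sums
  open Subsets
  open Hypergraphs
  open HomCount
  open TailBound
  open Sampling

  private variable
    r m n : ℕ

  n<2^n : ∀ n → n < 2 ^ n
  n<2^n zero    = s≤s z≤n
  n<2^n (suc n) = begin-strict
    suc n                ≤⟨ n<2^n n ⟩
    2 ^ n                <⟨ m<m+n (2 ^ n) (m^n>0 2 n) ⟩
    2 ^ n + 2 ^ n        ≡⟨ cong (2 ^ n +_) (+-identityʳ (2 ^ n)) ⟨
    2 ^ suc n            ∎
    where
    open ≤-Reasoning

  -- Bernoulli's inequality for `(1 + 1 / B) ^ B`.
  doubling : ∀ B .{{_ : NonZero B}} → 2 * B ^ B ≤ suc B ^ B
  doubling B@(suc b) = begin
    2 * (B * B ^ b)                  ≡⟨ expand B (B ^ b) ⟩
    B * B ^ b + B * 1 * B ^ b        ≤⟨ bernoulli B 1 b ⟩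
    (B + 1) ^ B                      ≡⟨ cong (_^ B) (+-comm B 1) ⟩
    suc B ^ B                        ∎
    where
    open ≤-Reasoning
    expand : ∀ B x → 2 * (B * x) ≡ B * x + B * 1 * x
    expand = solve-∀

  exponential-beats-power : ∀ c j → ∃[ u ] (c ≤ u × c * (2 ^ u) ^ j ≤ 2 ^ (2 ^ u))
  exponential-beats-power c j = u , c≤u , (begin
    c * (2 ^ u) ^ j              ≤⟨ *-mono-≤ (<⇒≤ (n<2^n c)) (≤-reflexive (^-*-assoc 2 u j)) ⟩
    2 ^ c * 2 ^ (u * j)          ≡⟨ ^-distribˡ-+-* 2 c (u * j) ⟨
    2 ^ (c + u * j)              ≤⟨ ^-monoʳ-≤ 2 exponent ⟩
    2 ^ (2 ^ u)                  ∎)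
    where
    open ≤-Reasoning
    -- Chosen so that `c + u * j ≤ w * (2 * j + c) ≤ w * w`, which is at most
    -- `2 ^ w * 2 ^ w = 2 ^ u`.
    w = suc (2 * j + c)
    u = w + w
    c≤u : c ≤ u
    c≤u = ≤-trans (≤-trans (m≤n+m c (2 * j)) (n≤1+n _)) (m≤m+n w w)
    factor : ∀ j c w → c * w + (w + w) * j ≡ w * (2 * j + c)
    factor = solve-∀
    exponent : c + u * j ≤ 2 ^ u
    exponent = begin
      c + u * j             ≤⟨ +-monoˡ-≤ (u * j) (m≤m*n c w) ⟩
      c * w + u * j         ≡⟨ factor j c w ⟩
      w * (2 * j + c)       ≤⟨ *-monoʳ-≤ w (n≤1+n _) ⟩
      w * w                 ≤⟨ *-mono-≤ (<⇒≤ (n<2^n w)) (<⇒≤ (n<2^n w)) ⟩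
      2 ^ w * 2 ^ w         ≡⟨ ^-distribˡ-+-* 2 w w ⟨
      2 ^ u                 ∎

  -- With `K = B * 2 ^ u`, `doubling` makes the ratio of `suc B ^ K` to `B ^ K` at least
  -- `2 ^ (2 ^ u)`, against a power of `2 ^ u`. This fixes the sample size: the Chernoff gain
  -- outweighs the union bound over `(Q * K) ^ j` tuples.
  growth : ∀ A Q j B .{{_ : NonZero B}} k₀ → ∃[ K ] (k₀ ≤ K × A * (Q * K) ^ j * B ^ K ≤ suc B ^ K)
  growth A Q j B k₀ = large (exponential-beats-power c j)
    where
    open ≤-Reasoning
    -- The summand `k₀` forces `k₀ ≤ u`, hence `k₀ ≤ K`.
    c = A * (Q * B) ^ j + k₀
    regroup : ∀ Q B L → Q * (B * L) ≡ Q * B * L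
    regroup = solve-∀
    large : ∃[ u ] (c ≤ u × c * (2 ^ u) ^ j ≤ 2 ^ (2 ^ u)) →
            ∃[ K ] (k₀ ≤ K × A * (Q * K) ^ j * B ^ K ≤ suc B ^ K)
    large (u , c≤u , bound) = K , k₀≤K , (begin
      A * (Q * K) ^ j * B ^ K
        ≡⟨ cong (λ x → A * x ^ j * B ^ K) (regroup Q B L) ⟩
      A * (Q * B * L) ^ j * B ^ K
        ≡⟨ cong (λ x → A * x * B ^ K) (^-distribʳ-* (Q * B) L j) ⟩
      A * ((Q * B) ^ j * L ^ j) * B ^ K
        ≡⟨ cong (_* B ^ K) (*-assoc A ((Q * B) ^ j) (L ^ j)) ⟨
      A * (Q * B) ^ j * L ^ j * B ^ K
        ≤⟨ *-monoˡ-≤ (B ^ K) (*-monoˡ-≤ (L ^ j) (m≤m+n (A * (Q * B) ^ j) k₀)) ⟩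
      c * L ^ j * B ^ K
        ≤⟨ *-monoˡ-≤ (B ^ K) bound ⟩
      2 ^ L * B ^ K
        ≡⟨ cong (2 ^ L *_) (^-*-assoc B B L) ⟨
      2 ^ L * (B ^ B) ^ L
        ≡⟨ ^-distribʳ-* 2 (B ^ B) L ⟨
      (2 * B ^ B) ^ L
        ≤⟨ ^-monoˡ-≤ L (doubling B) ⟩
      (suc B ^ B) ^ L
        ≡⟨ ^-*-assoc (suc B) B L ⟩
      suc B ^ K ∎)
      where
      L = 2 ^ u
      K = B * L
      k₀≤K : k₀ ≤ K
      k₀≤K = begin
        k₀     ≤⟨ m≤n+m k₀ (A * (Q * B) ^ j) ⟩
        c      ≤⟨ c≤u ⟩
        u      ≤⟨ <⇒≤ (n<2^n u) ⟩
        L      ≤⟨ m≤n*m L B ⟩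
        K      ∎

  n<[1+n/d]*d : ∀ n d .{{_ : NonZero d}} → n < suc (n / d) * d
  n<[1+n/d]*d n d = begin-strict
    n                      ≡⟨ m≡m%n+[m/n]*n n d ⟩
    n % d + n / d * d      <⟨ +-monoˡ-< (n / d * d) (m%n<n n d) ⟩
    suc (n / d) * d        ∎
    where open ≤-Reasoning

  module _ (F : RGraph (suc r) m) (F-edge : ∃[ e ] Edge F e) where

    edgeless-HomFree : HomFree F (edgeless {suc r} {n})
    edgeless-HomFree f hom = hom (proj₁ F-edge) (proj₂ F-edge)

    -- An edgeless `H` would have `δ⁺ H = 0`, against the density assumption, so there is an edge to
    -- start from. Then `edges-dense` with `c = Q` gives edge probability at least
    -- `1 / Q ^ suc r = 3 / A`.
    sample-if-dense : .{{_ : NonZero n}} → ∀ q p K .{{_ : NonZero K}} →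
      let Q = suc q ; B = suc (Q * Q) * suc (Q * Q) ; A = 3 * Q ^ suc r in
      suc r ≤ Q * K → A * (Q * K) ^ r * B ^ K ≤ suc B ^ K →
      (H : RGraph (suc r) n) → iteratedSquare m (A * (Q * K) ^ m) * (m * m) ≤ n → Free F H →
      p ≤ q → suc p * n ≤ Q * δ⁺ H →
      Σ[ H′ ∈ RGraph (suc r) (Q * K) ] (HomFree F H′ × p * K ≤ r + δ⁺ H′)
    sample-if-dense {n@(suc _)} q p K r<M grows H large free p≤q dense =
      ∃-good-sample F H free (Q * K) {{m*n≢0 Q K}} U ∣U∣ (p * K) (3 * Q ^ suc r) (B ^ K) (suc B ^ K) {{m^n≢0 (suc B) K}}
        (≤-trans (*-monoʳ-≤ 3 (edges-dense H Q n≤Qδ (hasEdge (anyEdge? H)) U ∣U∣ zero))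
                 (≤-reflexive (sym (*-assoc 3 (Q ^ suc r) _))))
        (deficient-rare H q p K p≤q dense) grows large
      where
      Q = suc q
      B = suc (Q * Q) * suc (Q * Q)
      U = proj₁ (subsetOfSize r<M)
      ∣U∣ = proj₂ (subsetOfSize r<M)
      n≤Qδ : n ≤ Q * δ⁺ H
      n≤Qδ = ≤-trans (m≤m+n n (p * n)) dense
      hasEdge : Dec (∃[ e ] Edge H e) → ∃[ e ] Edge H e
      hasEdge (yes e) = e
      hasEdge (no ¬e) = contradiction (subst (n ≤_) (trans (cong (Q *_) (δ⁺-edgeless H ¬e)) (*-zeroʳ Q)) n≤Qδ) λ ()

    -- The inequality is `δ⁺ H / n ≤ δ⁺ H′ / suc v + 3 / suc q`. The sample size is fixed before `n`
    -- and `H`.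
    BoundedSample : (q v n₀ : ℕ) → Set
    BoundedSample q v n₀ = ∀ n .{{_ : NonZero n}} (H : RGraph (suc r) n) → n₀ ≤ n → Free F H →
      Σ[ H′ ∈ RGraph (suc r) (suc v) ]
        (HomFree F H′ × suc q * suc v * δ⁺ H ≤ (suc q * δ⁺ H′ + 3 * suc v) * n)

    -- Three units of `1 / Q` are lost: by rounding the density of `H` down to a multiple of
    -- `1 / Q`, by the threshold one unit below it, and by the correction `r ≤ K`, which relative to
    -- `Q * K` is at most `1 / Q`.
    bounded-sample : ∀ q → ∃[ v ] ∃[ n₀ ] BoundedSample q v n₀
    bounded-sample q = choose (growth A Q r B (suc r))
      where
      open ≤-Reasoning
      Q = suc q
      B = suc (Q * Q) * suc (Q * Q)
      A = 3 * Q ^ suc r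
      choose : ∃[ K ] (suc r ≤ K × A * (Q * K) ^ r * B ^ K ≤ suc B ^ K) → ∃[ v ] ∃[ n₀ ] BoundedSample q v n₀
      -- The first component is the predecessor of `Q * K`, so `suc v` is the sample size by
      -- definition.
      choose (K@(suc K₋) , r<K , grows) = K₋ + q * K , iteratedSquare m (A * (Q * K) ^ m) * (m * m) , sample
        where
        M = Q * K
        sample : ∀ n .{{_ : NonZero n}} (H : RGraph (suc r) n) → iteratedSquare m (A * M ^ m) * (m * m) ≤ n → Free F H →
          Σ[ H′ ∈ RGraph (suc r) M ] (HomFree F H′ × Q * M * δ⁺ H ≤ (Q * δ⁺ H′ + 3 * M) * n)
        sample n H large free = by-density (Q * δ⁺ H / n) (m/n*n≤m (Q * δ⁺ H) n) (n<[1+n/d]*d (Q * δ⁺ H) n)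
          where
          rescale : ∀ P → Q * δ⁺ H < suc P * n → Q * M * δ⁺ H ≤ M * (suc P * n)
          rescale P Qδ< = begin
            Q * M * δ⁺ H          ≡⟨ cong (_* δ⁺ H) (*-comm Q M) ⟩
            M * Q * δ⁺ H          ≡⟨ *-assoc M Q (δ⁺ H) ⟩
            M * (Q * δ⁺ H)        ≤⟨ *-monoʳ-≤ M (<⇒≤ Qδ<) ⟩
            M * (suc P * n)       ∎
          by-density : ∀ P → P * n ≤ Q * δ⁺ H → Q * δ⁺ H < suc P * n →
            Σ[ H′ ∈ RGraph (suc r) M ] (HomFree F H′ × Q * M * δ⁺ H ≤ (Q * δ⁺ H′ + 3 * M) * n)
          -- A density below `1 / Q` is already covered by the error term, so the hom-free
          -- `edgeless` serves and nothing is sampled.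
          by-density zero _ Qδ<n = G , edgeless-HomFree , (begin
            Q * M * δ⁺ H                    ≤⟨ rescale 0 Qδ<n ⟩
            M * (1 * n)                     ≡⟨ *-assoc M 1 n ⟨
            M * 1 * n                       ≤⟨ *-monoˡ-≤ n (≤-trans (≤-reflexive (*-comm M 1)) (*-monoˡ-≤ M {1} {3} (s≤s z≤n))) ⟩
            3 * M * n                       ≤⟨ *-monoˡ-≤ n (m≤n+m (3 * M) (Q * δ⁺ G)) ⟩
            (Q * δ⁺ G + 3 * M) * n          ∎)
            where
            G : RGraph (suc r) M
            G = edgeless
          by-density (suc p) dense sparse = G , proj₁ (proj₂ G-good) , (begin
            Q * M * δ⁺ H                    ≤⟨ rescale (suc p) sparse ⟩
            M * (suc (suc p) * n)           ≡⟨ regroup Q K p n ⟩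
            (Q * (p * K) + 2 * M) * n       ≤⟨ *-monoˡ-≤ n (+-monoˡ-≤ (2 * M) (*-monoʳ-≤ Q pK≤)) ⟩
            (Q * (K + δ⁺ G) + 2 * M) * n    ≡⟨ cong (_* n) (collect Q K (δ⁺ G)) ⟩
            (Q * δ⁺ G + 3 * M) * n          ∎)
            where
            p≤q : p ≤ q
            p≤q = s≤s⁻¹ (*-cancelʳ-≤ (suc p) Q n (≤-trans dense (*-monoʳ-≤ Q (δ⁺≤n H))))
            G-good = sample-if-dense q p K (≤-trans r<K (m≤m+n K (q * K))) grows H large free p≤q dense
            G = proj₁ G-good
            pK≤ : p * K ≤ K + δ⁺ G
            pK≤ = ≤-trans (proj₂ (proj₂ G-good)) (+-monoˡ-≤ (δ⁺ G) (≤-trans (n≤1+n r) r<K))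
            regroup : ∀ Q K p n → Q * K * (suc (suc p) * n) ≡ (Q * (p * K) + 2 * (Q * K)) * n
            regroup = solve-∀
            collect : ∀ Q K d → Q * (K + d) + 2 * (Q * K) ≡ Q * d + 3 * (Q * K)
            collect = solve-∀

    -- A sample varies with `n` and the host hypergraph; the optimum depends on `F` and `v` alone,
    -- so one hypergraph serves all large `n`. The default `edgeless` is itself hom-free because `F`
    -- has an edge.
    bestHomFree : ∀ v → RGraph (suc r) v
    bestHomFree v = argmax δ⁺ edgeless (filter (HomFree? F) (rgraphs (suc r) v))

    bestHomFree-HomFree : ∀ v → HomFree F (bestHomFree v)
    bestHomFree-HomFree v = argmax-all δ⁺ edgeless-HomFree
      (All.tabulate λ G∈ → proj₂ (∈-filter⁻ (HomFree? F) {xs = rgraphs (suc r) v} G∈))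

    bestHomFree-max : ∀ {v} (H : RGraph (suc r) v) → HomFree F H → δ⁺ H ≤ δ⁺ (bestHomFree v)
    bestHomFree-max {v} H free = max (rgraphs-complete H)
      where
      max : ∃[ G ] (_ × edge H ≗ edge G) → δ⁺ H ≤ δ⁺ (bestHomFree v)
      max (G , G∈ , H≗G) = subst (_≤ δ⁺ (bestHomFree v)) (sym (δ⁺-cong H G H≗G))
        (All.lookup (f[xs]≤f[argmax] edgeless (filter (HomFree? F) (rgraphs (suc r) v)))
          (∈-filter⁺ (HomFree? F) G∈ λ f hom → free f λ e p → subst T (sym (H≗G _)) (hom e p)))

    -- With x = co⁺ex n F / n, y = δ⁺ (blowup H c) / n and β = δ⁺ H / suc v, the
    -- bounds read x ≤ β + 3 / suc q, β ≤ y + 1 / suc q and β ≤ x + 1 / suc q.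
    record Approximation (q v : ℕ) (H : RGraph (suc r) (suc v)) (n : ℕ) : Set where
      field
        upper : suc q * suc v * co⁺ex n F ≤ (suc q * δ⁺ H + 3 * suc v) * n
        lower : suc q * n * δ⁺ H ≤ (suc q * co⁺ex n F + n) * suc v
        lower-balanced : ∀ c → Balanced c → suc q * n * δ⁺ H ≤ (suc q * δ⁺ (blowup {N = n} H c) + n) * suc v

    -- Rounding `n / suc v` down costs at most `δ⁺ H ≤ suc v`, and this is at most `n / suc q` by
    -- the assumption on `n`.
    δ⁺-blowup-large : ∀ q {v} (H : RGraph (suc r) (suc v)) n → suc q * suc v ≤ n → ∀ (c : Fin n → Fin (suc v)) →
      (∀ i → n / suc v ≤ classSize c i) → suc q * n * δ⁺ H ≤ (suc q * δ⁺ (blowup H c) + n) * suc v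
    δ⁺-blowup-large q {v} H n large c sizes = begin
      Q * n * δ⁺ H                                        ≤⟨ *-monoˡ-≤ (δ⁺ H) (*-monoʳ-≤ Q (<⇒≤ (n<[1+n/d]*d n (suc v)))) ⟩
      Q * (suc (n / suc v) * suc v) * δ⁺ H                ≡⟨ regroup Q (n / suc v) (suc v) (δ⁺ H) ⟩
      (Q * (δ⁺ H * (n / suc v)) + Q * δ⁺ H) * suc v       ≤⟨ *-monoˡ-≤ (suc v) (+-mono-≤ (*-monoʳ-≤ Q (δ⁺-blowup H c (n / suc v) sizes))
                                                               (≤-trans (*-monoʳ-≤ Q (δ⁺≤n H)) large)) ⟩
      (Q * δ⁺ (blowup H c) + n) * suc v                   ∎
      where
      open ≤-Reasoning
      Q = suc q
      regroup : ∀ Q L v d → Q * (suc L * v) * d ≡ (Q * (d * L) + Q * d) * v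
      regroup = solve-∀

    approximate : ∀ q v n₀ → BoundedSample q v n₀ → ∀ n .{{_ : NonZero n}} → n₀ + suc q * suc v ≤ n →
                  Approximation q v (bestHomFree (suc v)) n
    approximate q v n₀ sample n n₀≤n = record
      { upper = upper (co⁺ex-attained n F F-edge)
      ; lower = lower (∃-equitable n)
      ; lower-balanced = λ c bal → δ⁺-blowup-large q H n large c (Balanced⇒classSize c bal)
      }
      where
      open ≤-Reasoning
      H = bestHomFree (suc v)
      large : suc q * suc v ≤ n
      large = ≤-trans (m≤n+m _ n₀) n₀≤n
      upper : Σ[ G ∈ RGraph (suc r) n ] (Free F G × δ⁺ G ≡ co⁺ex n F) →
              suc q * suc v * co⁺ex n F ≤ (suc q * δ⁺ H + 3 * suc v) * n
      upper (G , free , eq) = bound (sample n G (≤-trans (m≤m+n n₀ _) n₀≤n) free)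
        where
        bound : Σ[ H′ ∈ RGraph (suc r) (suc v) ]
                  (HomFree F H′ × suc q * suc v * δ⁺ G ≤ (suc q * δ⁺ H′ + 3 * suc v) * n) →
                suc q * suc v * co⁺ex n F ≤ (suc q * δ⁺ H + 3 * suc v) * n
        bound (H′ , homFree , le) = begin
          suc q * suc v * co⁺ex n F                   ≡⟨ cong (suc q * suc v *_) eq ⟨
          suc q * suc v * δ⁺ G                        ≤⟨ le ⟩
          (suc q * δ⁺ H′ + 3 * suc v) * n             ≤⟨ *-monoˡ-≤ n (+-monoˡ-≤ (3 * suc v) (*-monoʳ-≤ (suc q) (bestHomFree-max H′ homFree))) ⟩
          (suc q * δ⁺ H + 3 * suc v) * n              ∎
      -- Blow-ups of the hom-free `H` are `F`-free, so they compete in the maximum that defines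
      -- `co⁺ex`.
      lower : ∃[ c ] (∀ i → n / suc v ≤ classSize {n} c i) →
              suc q * n * δ⁺ H ≤ (suc q * co⁺ex n F + n) * suc v
      lower (c , sizes) = ≤-trans (δ⁺-blowup-large q H n large c sizes)
        (*-monoˡ-≤ (suc v) (+-monoˡ-≤ n (*-monoʳ-≤ (suc q)
          (co⁺ex-bound n F (blowup H c) (HomFree⇒Free F (blowup H c) (blowup-HomFree H c F (bestHomFree-HomFree (suc v))))))))

    ∃-approximation : ∀ q → ∃[ v ] Σ[ H ∈ RGraph (suc r) (suc v) ]
      (HomFree F H × ∃[ n₀ ] (∀ n .{{_ : NonZero n}} → n₀ ≤ n → Approximation q v H n))
    ∃-approximation q = choose (bounded-sample q)
      where
      choose : ∃[ v ] ∃[ n₀ ] BoundedSample q v n₀ → ∃[ v ] Σ[ H ∈ RGraph (suc r) (suc v) ]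
        (HomFree F H × ∃[ n₀ ] (∀ n .{{_ : NonZero n}} → n₀ ≤ n → Approximation q v H n))
      choose (v , n₀ , sample) =
        v , bestHomFree (suc v) , bestHomFree-HomFree (suc v) , n₀ + suc q * suc v , approximate q v n₀ sample

-- The limit as a real number

module Limit where

  open import Algebra.Properties.Group using (⁻¹-anti-homo-//)
  open import Data.Fin using (Fin)
  open import Data.Integer as ℤ using (+_; -[1+_])
  import Data.Integer.Properties as ℤ
  open import Data.Nat as ℕ using (ℕ; suc; NonZero)
  import Data.Nat.Properties as ℕ
  open import Data.Nat.Tactic.RingSolver using (solve-∀)
  open import Data.Product using (∃-syntax; Σ-syntax; _×_; _,_; proj₁; proj₂)
  open import Data.Rational using (ℚ; mkℚ; 0ℚ; ½; _+_; _-_; -_; _*_; _/_; _≤_; _<_; *<*; ∣_∣; toℚᵘ)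
  open import Data.Rational.Properties
  import Data.Rational.Unnormalised as ℚᵘ
  import Data.Rational.Unnormalised.Properties as ℚᵘ
  open import Data.Sum using (inj₁; inj₂)
  open import Relation.Binary.PropositionalEquality

  open import Defs using (RGraph; Edge; Balanced; blowup; δ⁺; co⁺ex; ℝ; seq; cauchy)
  import Defs as ℝ
  open Hypergraphs using (HomFree)
  open Approximation

  private variable
    r m : ℕ

  toℚᵘ-/ : ∀ a n .{{_ : NonZero n}} → toℚᵘ (+ a / n) ℚᵘ.≃ (+ a ℚᵘ./ n)
  toℚᵘ-/ a (suc n) = toℚᵘ-fromℚᵘ (ℚᵘ.mkℚᵘ (+ a) n)

  /-≤-/+/ : ∀ a n d v c q .{{_ : NonZero n}} → suc q ℕ.* suc v ℕ.* a ℕ.≤ (suc q ℕ.* d ℕ.+ c ℕ.* suc v) ℕ.* n →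
            + a / n ≤ + d / suc v + + c / suc q
  /-≤-/+/ a n@(suc n₋) d v c q h = toℚᵘ-cancel-≤ (begin
    toℚᵘ (+ a / n)                                ≃⟨ toℚᵘ-/ a n ⟩
    + a ℚᵘ./ n                                    ≤⟨ ℚᵘ.*≤* integral ⟩
    (+ d ℚᵘ./ suc v) ℚᵘ.+ (+ c ℚᵘ./ suc q)        ≃⟨ ℚᵘ.+-cong (toℚᵘ-/ d (suc v)) (toℚᵘ-/ c (suc q)) ⟨
    toℚᵘ (+ d / suc v) ℚᵘ.+ toℚᵘ (+ c / suc q)    ≃⟨ toℚᵘ-homo-+ (+ d / suc v) (+ c / suc q) ⟨
    toℚᵘ (+ d / suc v + + c / suc q)              ∎)
    where
    open ℚᵘ.≤-Reasoning
    left : ∀ a v q → a ℕ.* (v ℕ.* q) ≡ q ℕ.* v ℕ.* a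
    left = solve-∀
    integral : + a ℤ.* + (suc v ℕ.* suc q) ℤ.≤ (+ d ℤ.* + suc q ℤ.+ + c ℤ.* + suc v) ℤ.* + n
    integral = subst₂ ℤ._≤_ (ℤ.pos-* a (suc v ℕ.* suc q))
      (trans (ℤ.pos-* (d ℕ.* suc q ℕ.+ c ℕ.* suc v) n)
        (cong (ℤ._* + n) (trans (ℤ.pos-+ (d ℕ.* suc q) (c ℕ.* suc v)) (cong₂ ℤ._+_ (ℤ.pos-* d (suc q)) (ℤ.pos-* c (suc v))))))
      (ℤ.+≤+ (subst₂ ℕ._≤_ (sym (left a (suc v) (suc q)))
        (cong (λ x → (x ℕ.+ c ℕ.* suc v) ℕ.* n) (ℕ.*-comm (suc q) d)) h))

  archimedean : ∀ c ε → 0ℚ < ε → ∃[ q ] + c / suc q ≤ ε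
  archimedean c ε@(mkℚ (+ 0) d _) (*<* (ℤ.+<+ ()))
  archimedean c ε@(mkℚ (-[1+ _ ]) d _) (*<* ())
  -- Here `ε` is `suc k / suc d`, and its numerator is at least one, so `c * suc d ≤ suc q`
  -- suffices.
  archimedean c ε@(mkℚ (+ suc k) d _) 0<ε = c ℕ.* suc d , toℚᵘ-cancel-≤ (begin
    toℚᵘ (+ c / suc q)         ≃⟨ toℚᵘ-/ c (suc q) ⟩
    + c ℚᵘ./ suc q             ≤⟨ ℚᵘ.*≤* (subst₂ ℤ._≤_ (ℤ.pos-* c (suc d)) (ℤ.pos-* (suc k) (suc q))
                                    (ℤ.+≤+ (ℕ.≤-trans (ℕ.n≤1+n q) (ℕ.m≤n*m (suc q) (suc k))))) ⟩
    toℚᵘ ε                     ∎)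
    where
    open ℚᵘ.≤-Reasoning
    q = c ℕ.* suc d

  ½+½ : ∀ ε → ½ * ε + ½ * ε ≡ ε
  ½+½ ε = trans (sym (*-distribʳ-+ ε ½ ½)) (*-identityˡ ε)

  0<½* : ∀ {ε} → 0ℚ < ε → 0ℚ < ½ * ε
  0<½* {ε} 0<ε = subst (_< ½ * ε) (*-zeroʳ ½) (*-monoʳ-<-pos ½ 0<ε)

  ½*< : ∀ {ε} → 0ℚ < ε → ½ * ε < ε
  ½*< {ε} 0<ε = begin-strict
    ½ * ε              ≡⟨ +-identityʳ (½ * ε) ⟨
    ½ * ε + 0ℚ         <⟨ +-monoʳ-< (½ * ε) (0<½* 0<ε) ⟩
    ½ * ε + ½ * ε      ≡⟨ ½+½ ε ⟩
    ε                  ∎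
    where open ≤-Reasoning

  p≤q+r⇒p-q≤r : ∀ {p q r} → p ≤ q + r → p - q ≤ r
  p≤q+r⇒p-q≤r {p} {q} {r} h = begin
    p - q              ≤⟨ +-monoˡ-≤ (- q) h ⟩
    q + r - q          ≡⟨ cong (λ x → x - q) (+-comm q r) ⟩
    r + q - q          ≡⟨ +-assoc r q (- q) ⟩
    r + (q - q)        ≡⟨ cong (λ x → r + x) (+-inverseʳ q) ⟩
    r + 0ℚ             ≡⟨ +-identityʳ r ⟩
    r                  ∎
    where open ≤-Reasoning

  ∣p-q∣≤ : ∀ {p q r} → p ≤ q + r → q ≤ p + r → ∣ p - q ∣ ≤ r
  ∣p-q∣≤ {p} {q} {r} h h′ with ∣p∣≡p∨∣p∣≡-p (p - q)
  ... | inj₁ eq = subst (_≤ r) (sym eq) (p≤q+r⇒p-q≤r h)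
  ... | inj₂ eq = subst (_≤ r) (sym (trans eq (⁻¹-anti-homo-// +-0-group p q))) (p≤q+r⇒p-q≤r h′)

  -- The order on `ℝ` demands a rational gap: half of `δ` pays for the error in the assumption, the
  -- other half is the gap.
  subtract-more : ∀ {x y δ ε} → x ≤ y + ½ * δ → δ ≤ ε → x - ε + ½ * δ ≤ y
  subtract-more {x} {y} {δ} {ε} x≤ δ≤ε = begin
    x - ε + ½ * δ                      ≤⟨ +-monoˡ-≤ (½ * δ) (+-mono-≤ x≤ (neg-antimono-≤ δ≤ε)) ⟩
    y + ½ * δ - δ + ½ * δ              ≡⟨ regroup y (½ * δ) (- δ) ⟩
    y + (½ * δ + ½ * δ - δ)            ≡⟨ cong (λ x → y + (x - δ)) (½+½ δ) ⟩
    y + (δ - δ)                        ≡⟨ cong (λ x → y + x) (+-inverseʳ δ) ⟩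
    y + 0ℚ                             ≡⟨ +-identityʳ y ⟩
    y                                  ∎
    where
    open ≤-Reasoning
    regroup : ∀ y h d → y + h + d + h ≡ y + (h + h + d)
    regroup y h d = begin-equality
      y + h + d + h       ≡⟨ +-assoc (y + h) d h ⟩
      y + h + (d + h)     ≡⟨ +-assoc y h (d + h) ⟩
      y + (h + (d + h))   ≡⟨ cong (λ x → y + (h + x)) (+-comm d h) ⟩
      y + (h + (h + d))   ≡⟨ cong (λ x → y + x) (+-assoc h h d) ⟨
      y + (h + h + d)     ∎

  add-more : ∀ {x y δ ε} → x ≤ y + ½ * δ → δ ≤ ε → x + ½ * δ ≤ y + ε
  add-more {x} {y} {δ} {ε} x≤ δ≤ε = begin
    x + ½ * δ                  ≤⟨ +-monoˡ-≤ (½ * δ) x≤ ⟩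
    y + ½ * δ + ½ * δ          ≡⟨ +-assoc y (½ * δ) (½ * δ) ⟩
    y + (½ * δ + ½ * δ)        ≡⟨ cong (λ x → y + x) (½+½ δ) ⟩
    y + δ                      ≤⟨ +-monoʳ-≤ y δ≤ε ⟩
    y + ε                      ∎
    where open ≤-Reasoning

  open Approximation.Approximation

  module _ (F : RGraph (suc r) m) (F-edge : ∃[ e ] Edge F e) where

    ratio : (n : ℕ) .{{_ : NonZero n}} → ℚ
    ratio n = + co⁺ex n F / n

    -- The density `+ δ⁺ H / suc v` is a pivot: ratios at two different large `n` are compared
    -- through it.
    Within : ℚ → (v : ℕ) → RGraph (suc r) (suc v) → (n : ℕ) .{{_ : NonZero n}} → Set
    Within e v H n =
      ratio n ≤ + δ⁺ H / suc v + e ×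
      + δ⁺ H / suc v ≤ ratio n + e ×
      (∀ (c : Fin n → Fin (suc v)) → Balanced c → + δ⁺ H / suc v ≤ + δ⁺ (blowup H c) / n + e)

    Approximation⇒Within : ∀ {q v H n} .{{_ : NonZero n}} → Approximation F F-edge q v H n →
                           ∀ {e} → + 3 / suc q ≤ e → Within e v H n
    Approximation⇒Within {q} {v} {H} {n@(suc n₋)} approx {e} 3/Q≤e =
      ≤-trans (/-≤-/+/ (co⁺ex n F) n (δ⁺ H) v 3 q (upper approx)) (+-monoʳ-≤ (+ δ⁺ H / suc v) 3/Q≤e) ,
      lower-bound (δ⁺ H) (co⁺ex n F) (lower approx) ,
      λ c bal → lower-bound (δ⁺ H) (δ⁺ (blowup H c)) (lower-balanced approx c bal)
      where
      -- The error `1 / suc q` is relaxed to `3 / suc q`, so one bound `e` serves all three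
      -- components.
      weaken : ∀ d y → suc q ℕ.* n ℕ.* d ℕ.≤ (suc q ℕ.* y ℕ.+ n) ℕ.* suc v →
               suc q ℕ.* n ℕ.* d ℕ.≤ (suc q ℕ.* y ℕ.+ 3 ℕ.* n) ℕ.* suc v
      weaken d y h = ℕ.≤-trans h (ℕ.*-monoˡ-≤ (suc v) (ℕ.+-monoʳ-≤ (suc q ℕ.* y) (ℕ.m≤n*m n 3)))
      lower-bound : ∀ d y → suc q ℕ.* n ℕ.* d ℕ.≤ (suc q ℕ.* y ℕ.+ n) ℕ.* suc v → + d / suc v ≤ + y / n + e
      lower-bound d y h = ≤-trans (/-≤-/+/ d (suc v) y n₋ 3 q (weaken d y h)) (+-monoʳ-≤ (+ y / n) 3/Q≤e)

    EventuallyWithin : ℚ → Set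
    EventuallyWithin e = ∃[ v ] Σ[ H ∈ RGraph (suc r) (suc v) ]
      (HomFree F H × ∃[ n₀ ] (∀ n .{{_ : NonZero n}} → n₀ ℕ.≤ n → Within e v H n))

    eventuallyWithin : ∀ e → 0ℚ < e → EventuallyWithin e
    eventuallyWithin e 0<e = choose (archimedean 3 e 0<e)
      where
      choose : ∃[ q ] + 3 / suc q ≤ e → EventuallyWithin e
      choose (q , 3/Q≤e) = conclude (∃-approximation F F-edge q)
        where
        conclude : ∃[ v ] Σ[ H ∈ RGraph (suc r) (suc v) ]
          (HomFree F H × ∃[ n₀ ] (∀ n .{{_ : NonZero n}} → n₀ ℕ.≤ n → Approximation F F-edge q v H n)) → EventuallyWithin e
        conclude (v , H , free , n₀ , approx) = v , H , free , n₀ , λ n n₀≤n → Approximation⇒Within (approx n n₀≤n) 3/Q≤e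

    chain : ∀ {x β y e} → x ≤ β + ½ * e → β ≤ y + ½ * e → x ≤ y + e
    chain {x} {β} {y} {e} x≤ β≤ = begin
      x                             ≤⟨ x≤ ⟩
      β + ½ * e                     ≤⟨ +-monoˡ-≤ (½ * e) β≤ ⟩
      y + ½ * e + ½ * e             ≡⟨ +-assoc y (½ * e) (½ * e) ⟩
      y + (½ * e + ½ * e)           ≡⟨ cong (λ x → y + x) (½+½ e) ⟩
      y + e                         ∎
      where open ≤-Reasoning

    ratio-close : ∀ e v (H : RGraph (suc r) (suc v)) n k .{{_ : NonZero n}} .{{_ : NonZero k}} →
                  Within (½ * e) v H n → Within (½ * e) v H k → ratio n ≤ ratio k + e
    ratio-close e v H n k (ratio≤ , _) (_ , ≤ratio , _) =
      chain {ratio n} {+ δ⁺ H / suc v} {ratio k} {e} ratio≤ ≤ratio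

    -- The ratios themselves represent the limit, shifted by one index to keep the denominators
    -- nonzero.
    γ⁺ : ℝ
    γ⁺ .seq i = ratio (suc i)
    -- A quarter of `ε` on each side of the pivot adds up to `½ * ε`, and the remaining half makes
    -- the inequality strict.
    γ⁺ .cauchy ε 0<ε = choose (eventuallyWithin (½ * (½ * ε)) (0<½* (0<½* 0<ε)))
      where
      choose : EventuallyWithin (½ * (½ * ε)) →
        ∃[ N ] (∀ i j → N ℕ.≤ i → N ℕ.≤ j → ∣ ratio (suc i) - ratio (suc j) ∣ < ε)
      choose (v , H , _ , n₀ , within) = n₀ , λ i j n₀≤i n₀≤j →
        let wᵢ = within (suc i) (ℕ.m≤n⇒m≤1+n n₀≤i)
            wⱼ = within (suc j) (ℕ.m≤n⇒m≤1+n n₀≤j)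
        in ≤-<-trans (∣p-q∣≤ (ratio-close (½ * ε) v H (suc i) (suc j) wᵢ wⱼ) (ratio-close (½ * ε) v H (suc j) (suc i) wⱼ wᵢ)) (½*< 0<ε)

    -- The parameters unfold `0ℝ < ε`: from index `N` on, `ε` is at least the rational `δ`, against
    -- which all errors are measured.
    module _ (ε : ℝ) {δ} (0<δ : 0ℚ < δ) (N : ℕ) (δ≤ε : ∀ i → N ℕ.≤ i → 0ℚ + δ ≤ seq ε i) where

      δ≤ : ∀ i → N ℕ.≤ i → δ ≤ seq ε i
      δ≤ i N≤i = subst (_≤ seq ε i) (+-identityˡ δ) (δ≤ε i N≤i)

      γ⁺-ε< : ∀ k n .{{_ : NonZero n}} n₀ →
              (∀ i → n₀ ℕ.≤ i → ratio (suc i) ≤ + k / n + ½ * δ) → γ⁺ ℝ.- ε ℝ.< k ℝ.÷ n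
      γ⁺-ε< k n n₀ h = ½ * δ , 0<½* 0<δ , n₀ ℕ.⊔ N , λ i i≥ →
        subtract-more {ratio (suc i)} {+ k / n} {δ} {seq ε i}
          (h i (ℕ.m⊔n≤o⇒m≤o n₀ N i≥)) (δ≤ i (ℕ.m⊔n≤o⇒n≤o n₀ N i≥))

      <γ⁺+ε : ∀ k n .{{_ : NonZero n}} n₀ →
              (∀ i → n₀ ℕ.≤ i → + k / n ≤ ratio (suc i) + ½ * δ) → k ℝ.÷ n ℝ.< γ⁺ ℝ.+ ε
      <γ⁺+ε k n n₀ h = ½ * δ , 0<½* 0<δ , n₀ ℕ.⊔ N , λ i i≥ →
        add-more {+ k / n} {ratio (suc i)} {δ} {seq ε i}
          (h i (ℕ.m⊔n≤o⇒m≤o n₀ N i≥)) (δ≤ i (ℕ.m⊔n≤o⇒n≤o n₀ N i≥))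

      ratio-near-γ⁺ : ∃[ n₀ ] (∀ n .{{_ : NonZero n}} → n₀ ℕ.≤ n →
        (γ⁺ ℝ.- ε ℝ.< co⁺ex n F ℝ.÷ n) × (co⁺ex n F ℝ.÷ n ℝ.< γ⁺ ℝ.+ ε))
      ratio-near-γ⁺ = choose (eventuallyWithin (½ * (½ * δ)) (0<½* (0<½* 0<δ)))
        where
        choose : EventuallyWithin (½ * (½ * δ)) → ∃[ n₀ ] (∀ n .{{_ : NonZero n}} → n₀ ℕ.≤ n →
          (γ⁺ ℝ.- ε ℝ.< co⁺ex n F ℝ.÷ n) × (co⁺ex n F ℝ.÷ n ℝ.< γ⁺ ℝ.+ ε))
        choose (v , H , _ , n₀ , within) = n₀ , λ n n₀≤n →
          γ⁺-ε< (co⁺ex n F) n n₀ (λ i n₀≤i →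
            ratio-close (½ * δ) v H (suc i) n (within (suc i) (ℕ.m≤n⇒m≤1+n n₀≤i)) (within n n₀≤n)) ,
          <γ⁺+ε (co⁺ex n F) n n₀ (λ i n₀≤i →
            ratio-close (½ * δ) v H n (suc i) (within n n₀≤n) (within (suc i) (ℕ.m≤n⇒m≤1+n n₀≤i)))

      NearExtremal : (v : ℕ) → RGraph (suc r) (suc v) → ℕ → Set
      NearExtremal v H n₀ = ∀ n .{{_ : NonZero n}} → n₀ ℕ.≤ n → ∀ (c : Fin n → Fin (suc v)) → Balanced c →
                            γ⁺ ℝ.- ε ℝ.< δ⁺ (blowup H c) ℝ.÷ n

      near-extremal-blowups : ∃[ v ] Σ[ H ∈ RGraph (suc r) (suc v) ] (HomFree F H × ∃[ n₀ ] NearExtremal v H n₀)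
      near-extremal-blowups = choose (eventuallyWithin (½ * (½ * δ)) (0<½* (0<½* 0<δ)))
        where
        choose : EventuallyWithin (½ * (½ * δ)) →
                 ∃[ v ] Σ[ H ∈ RGraph (suc r) (suc v) ] (HomFree F H × ∃[ n₀ ] NearExtremal v H n₀)
        choose (v , H , free , n₀ , within) = v , H , free , n₀ , near
          where
          near : NearExtremal v H n₀
          -- The upper bound is read at `suc i`, the blow-up bound at `n`; both go through the
          -- density of the same `H`.
          near n n₀≤n c bal = γ⁺-ε< (δ⁺ (blowup H c)) n n₀ λ i n₀≤i →
            chain {ratio (suc i)} {+ δ⁺ H / suc v} {+ δ⁺ (blowup H c) / n} {½ * δ}
              (proj₁ (within (suc i) (ℕ.m≤n⇒m≤1+n n₀≤i))) (proj₂ (proj₂ (within n n₀≤n)) c bal)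

-- Proof of the theorem

open import Data.Fin using (Fin)
open import Data.Nat using (ℕ; suc; NonZero; _≤_; s≤s)
open import Data.Product using (Σ-syntax; ∃-syntax; _×_; _,_)
open import Defs
open Hypergraphs
open Limit

theorem22 : ∀ (r m : ℕ) (F : RGraph r m) → 2 ≤ r → ∃[ e ] Edge F e →
    Σ[ γ⁺ ∈ ℝ ]
    ( ((λ n → co⁺ex n F ÷ n) ⟶ γ⁺)
    × (∀ (ε : ℝ) → 0ℝ < ε →
    ∃[ v ] Σ[ H ∈ RGraph r (suc v) ]
    ( Free F H
    × (∀ N (c : Fin N → Fin (suc v)) → Free F (blowup H c))
    × ∃[ n₀ ] (∀ n .{{_ : NonZero n}} → n₀ ≤ n →
    ∀ (c : Fin n → Fin (suc v)) → Balanced c →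
    γ⁺ - ε < δ⁺ (blowup H c) ÷ n))))
theorem22 (suc r) m F (s≤s _) F-edge =
  γ⁺ F F-edge ,
  (λ ε (δ , 0<δ , N , δ≤ε) → ratio-near-γ⁺ F F-edge ε 0<δ N δ≤ε) ,
  λ ε (δ , 0<δ , N , δ≤ε) → blowups ε (near-extremal-blowups F F-edge ε 0<δ N δ≤ε)
  where
  blowups : ∀ ε →
    ∃[ v ] Σ[ H ∈ RGraph (suc r) (suc v) ]
      (HomFree F H × ∃[ n₀ ] (∀ n .{{_ : NonZero n}} → n₀ ≤ n →
        ∀ (c : Fin n → Fin (suc v)) → Balanced c → γ⁺ F F-edge - ε < δ⁺ (blowup H c) ÷ n)) →
    ∃[ v ] Σ[ H ∈ RGraph (suc r) (suc v) ]
      (Free F H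
      × (∀ N (c : Fin N → Fin (suc v)) → Free F (blowup H c))
      × ∃[ n₀ ] (∀ n .{{_ : NonZero n}} → n₀ ≤ n →
        ∀ (c : Fin n → Fin (suc v)) → Balanced c → γ⁺ F F-edge - ε < δ⁺ (blowup H c) ÷ n))
  blowups ε (v , H , free , near) =
    v , H , HomFree⇒Free F H free ,
    (λ N c → HomFree⇒Free F (blowup H c) (blowup-HomFree H c F free)) , near
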